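{- For any planar binary tree $t$, the coproduct of $\mathit{LR}$ satisfies $$\Delta(M^*_t)=\sum_{\mathsf{S}}M^*_{t'_\mathsf{S}}\otimes M^*_{t''_\mathsf{S}},$$ the sum over all admissible subsets $\mathsf{S}$ of internal nodes of $t$.
   Context: $\mathcal{Y}_n$: rooted planar binary trees with $n$ internal nodes, $\mathcal{Y}_0=\{|\}$, each $t$ ($n\ge1$) uniquely $t_l\vee t_r$ (grafting $t_l,t_r$ onto the left and right leaves of a root node); Tamari order generated by replacing a subtree $(A\vee B)\vee C$ by $A\vee(B\vee C)$. $|\backslash t=t$, $s\backslash t=s_l\vee(s_r\backslash t)$. $\mathcal{Y}Sym$: the graded Hopf algebra over $\mathbb{Q}$ with basis $F_t$, product $F_s\cdot F_t=\sum_{\zeta\in\mathrm{Sh}(p,q)}F_{\lambda((\gamma(s)/\gamma(t))\cdot\zeta^{ -1})}$ ($s\in\mathcal{Y}_p,t\in\mathcal{Y}_q$) and coproduct $\Delta F_t=\sum_{i}F_{\lambda(\mathrm{st}(\gamma(t)(1..i)))}\otimes F_{\lambda(\mathrm{st}(\gamma(t)(i+1..n)))}$, where: permutations are in one-line notation, $(\sigma\cdot\zeta)(i)=\sigma(\zeta(i))$, $\sigma/\tau$ has values $\sigma(1),\dots,\sigma(p),\tau(1)+p,\dots,\tau(q)+p$, $\sigma\vee\tau$ has values $\sigma(1)+q,\dots,\sigma(p)+q,p+q+1,\tau(1),\dots,\tau(q)$, $\mathrm{Sh}(p,q)$ = permutations of $[p+q]$ with no descent except possibly at $p$, st = standardization,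 $\lambda(\mathrm{id}_0)=|$, $\lambda(\sigma)=\lambda(\mathrm{st}(\sigma(1..j-1)))\vee\lambda(\mathrm{st}(\sigma(j+1..n)))$ with $j=\sigma^{ -1}(n)$, $\gamma(|)=\mathrm{id}_0$, $\gamma(t)=\gamma(t_l)\vee\gamma(t_r)$. Monomial basis $M_t=\sum_{s\ge t}\mu_{\mathcal{Y}_n}(t,s)F_s$. $\mathit{LR}$ is the graded dual Hopf algebra of $\mathcal{Y}Sym$, $\{M^*_t\}$ the basis dual to $\{M_t\}$. Admissible sets and pruning: a subset $\mathsf{R}$ of internal nodes of a tree is admissible if for every $x\in\mathsf{R}$, all internal nodes in the left subtree above $x$ lie in $\mathsf{R}$. Cutting every edge joining a node of $\mathsf{R}$ to a node not in $\mathsf{R}$ produces a forest of pruned pieces, assembled (left to right) into $r'_\mathsf{R}$ via $\backslash$, and a forest of remaining pieces, reassembled into $r''_\mathsf{R}$ by attaching each piece to the leaf below it. Precisely, $r'_\mathsf{R}$ and $r''_\mathsf{R}$ are defined recursively: for $r=|$ (and $\mathsf{R}=\emptyset$), $r'_\mathsf{R}=r''_\mathsf{R}=|$; for $r=s\vee t$ with root node $x$, letting $\mathsf{S}=\mathsf{R}\cap s$ and $\mathsf{T}=\mathsf{R}\cap t$ (both admissible): if $x\in\mathsf{R}$ (then all internal nodes of $s$ lie in $\mathsf{R}$), $r'_\mathsf{R}=s\vee t'_\mathsf{T}$ and $r''_\mathsf{R}=t''_\mathsf{T}$; if $x\notin\mathsf{R}$, $r'_\mathsf{R}=s'_\mathsf{S}\backslash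 t'_\mathsf{T}$ and $r''_\mathsf{R}=s''_\mathsf{S}\vee t''_\mathsf{T}$. -}

module Defs where

open import Data.Nat as ℕ using (ℕ; zero; suc; _+_; _∸_; _<_; _≤_; _<ᵇ_; _≡ᵇ_; s≤s; z≤n)
import Data.Nat.Properties as ℕP
open import Data.Nat.Solver using (module +-*-Solver)
open import Data.Integer as ℤ using (ℤ; +_; -_) renaming (_+_ to _+ℤ_; _*_ to _*ℤ_)
open import Data.Bool using (Bool; true; false; _∧_; not; if_then_else_)
open import Data.List using (List; []; _∷_; _++_; map; concatMap; filterᵇ; length; take; drop; foldr; upTo)
open import Data.List.Membership.Propositional using (_∈_)
open import Data.List.Membership.Propositional.Properties using (∈-map⁺; ∈-map⁻; ∈-++⁺ˡ; ∈-++⁺ʳ; ∈-++⁻)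
open import Data.List.Relation.Unary.Any using (here; there)
open import Data.Product using (_×_; _,_; proj₁; proj₂; ∃)
open import Data.Sum using (inj₁; inj₂)
open import Relation.Binary.PropositionalEquality using (_≡_; refl; sym; cong; subst)
open import Relation.Nullary using (Dec; yes; no; does; ¬_)
open import Relation.Binary.Construct.Closure.ReflexiveTransitive using (Star; ε; _◅_)

data Tree : Set where
  leaf : Tree
  node : Tree → Tree → Tree

size : Tree → ℕ
size leaf       = 0
size (node l r) = suc (size l + size r)

upToHeight : ℕ → List Tree
upToHeight zero    = leaf ∷ []
upToHeight (suc n) = leaf ∷ concatMap (λ l → map (node l) (upToHeight n)) (upToHeight n)

-- 𝒴_n : all trees with n internal nodes, each exactly once
-- (a tree with n internal nodes has height ≤ n)
𝒴 : ℕ → List Tree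
𝒴 n = filterᵇ (λ t → size t ≡ᵇ n) (upToHeight n)

_≟T_ : (s t : Tree) → Dec (s ≡ t)
leaf ≟T leaf = yes refl
leaf ≟T node _ _ = no λ ()
node _ _ ≟T leaf = no λ ()
node a b ≟T node c d with a ≟T c | b ≟T d
... | yes refl | yes refl = yes refl
... | no p | _ = no λ { refl → p refl }
... | yes _ | no q = no λ { refl → q refl }

eqᵇ : Tree → Tree → Bool
eqᵇ s t = does (s ≟T t)

data _⟶_ : Tree → Tree → Set where
  rot   : ∀ A B C → node (node A B) C ⟶ node A (node B C)
  congˡ : ∀ {s s'} t → s ⟶ s' → node s t ⟶ node s' t
  congʳ : ∀ s {t t'} → t ⟶ t' → node s t ⟶ node s t'

_≤T_ : Tree → Tree → Set
_≤T_ = Star _⟶_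

rotTop : Tree → Tree → List Tree
rotTop leaf C = []
rotTop (node A B) C = node A (node B C) ∷ []

rots : Tree → List Tree
rots leaf = []
rots (node l r) = rotTop l r ++ (map (λ l' → node l' r) (rots l) ++ map (node l) (rots r))

rots-sound : ∀ {t s} → s ∈ rots t → t ⟶ s
rots-sound {leaf} ()
rots-sound {node l r} m with ∈-++⁻ (rotTop l r) m
rots-sound {node (node A B) C} m | inj₁ (here refl) = rot A B C
rots-sound {node l r} m | inj₂ m' with ∈-++⁻ (map (λ l' → node l' r) (rots l)) m'
... | inj₁ m'' with ∈-map⁻ _ m''
...   | (x , x∈ , refl) = congˡ r (rots-sound x∈)
rots-sound {node l r} m | inj₂ m' | inj₂ m'' with ∈-map⁻ _ m''
...   | (x , x∈ , refl) = congʳ l (rots-sound x∈)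

rots-complete : ∀ {t s} → t ⟶ s → s ∈ rots t
rots-complete (rot A B C) = here refl
rots-complete (congˡ {s} t st) =
  ∈-++⁺ʳ (rotTop s t) (∈-++⁺ˡ (∈-map⁺ (λ l' → node l' t) (rots-complete st)))
rots-complete (congʳ s {t} st) =
  ∈-++⁺ʳ (rotTop s t) (∈-++⁺ʳ (map (λ l' → node l' t) (rots s)) (∈-map⁺ (node s) (rots-complete st)))

wt : Tree → ℕ
wt leaf = 0
wt (node l r) = size l + wt l + wt r

open +-*-Solver

size-rot : ∀ a b c → a + suc (b + c) ≡ suc (a + b) + c
size-rot = solve 3 (λ a b c → a :+ (con 1 :+ (b :+ c)) := (con 1 :+ (a :+ b)) :+ c) refl

size-step : ∀ {t s} → t ⟶ s → size s ≡ size t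
size-step (rot A B C) = cong suc (size-rot (size A) (size B) (size C))
size-step (congˡ t st) rewrite size-step st = refl
size-step (congʳ s st) rewrite size-step st = refl

rot-eq : ∀ a b c wa wb wc →
  suc (a + b) + (a + wa + wb) + wc ≡ suc ((a + wa + (b + wb + wc)) + a)
rot-eq = solve 6 (λ a b c wa wb wc →
  (con 1 :+ (a :+ b)) :+ (a :+ wa :+ wb) :+ wc
    := con 1 :+ ((a :+ wa :+ (b :+ wb :+ wc)) :+ a)) refl

wt-step : ∀ {t s} → t ⟶ s → wt s < wt t
wt-step (rot A B C) rewrite rot-eq (size A) (size B) (size C) (wt A) (wt B) (wt C) =
  s≤s (ℕP.m≤m+n _ (size A))
wt-step (congˡ {s} {s'} t st) rewrite size-step st =
  ℕP.+-monoˡ-< (wt t) (ℕP.+-monoʳ-< (size s) (wt-step st))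
wt-step (congʳ s st) = ℕP.+-monoʳ-< (size s + wt s) (wt-step st)

mutual
  reach : (k : ℕ) (t s : Tree) → wt t < k → Dec (t ≤T s)
  reach zero t s ()
  reach (suc k) t s w< with t ≟T s
  ... | yes refl = yes ε
  ... | no t≢s with anyReach k t s w< (rots t) rots-sound
  ...   | yes (r , r∈ , r≤s) = yes (rots-sound r∈ ◅ r≤s)
  ...   | no ¬p = no λ { ε → t≢s refl ; (st ◅ p) → ¬p (_ , rots-complete st , p) }

  anyReach : (k : ℕ) (t s : Tree) → wt t < suc k → (l : List Tree) →
             (∀ {r} → r ∈ l → t ⟶ r) → Dec (∃ λ r → r ∈ l × r ≤T s)
  anyReach k t s w< [] snd = no λ { (_ , () , _) }
  anyReach k t s w< (r ∷ l) snd
    with reach k r s (ℕP.<-≤-trans (wt-step (snd (here refl))) (ℕP.≤-pred w<))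
  ... | yes p = yes (r , here refl , p)
  ... | no ¬p with anyReach k t s w< l (λ m → snd (there m))
  ...   | yes (x , x∈ , q) = yes (x , there x∈ , q)
  ...   | no ¬q = no λ { (_ , here refl , p) → ¬p p ; (x , there x∈ , q) → ¬q (x , x∈ , q) }

_≤T?_ : (s t : Tree) → Dec (s ≤T t)
s ≤T? t = reach (suc (wt s)) s t ℕP.≤-refl

leqᵇ : Tree → Tree → Bool
leqᵇ s t = does (s ≤T? t)

-- Möbius function of the Tamari order on 𝒴_n:
--   μ(s,s) = 1,  μ(s,t) = - Σ_{s ≤ u < t} μ(s,u)  for s < t,  0 otherwise.
-- Defined with fuel; fuel  suc (wt s)  suffices since wt strictly
-- decreases along strict Tamari relations and is ≥ 0.

sumℤ : List ℤ → ℤ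
sumℤ = foldr _+ℤ_ (+ 0)

mobF : ℕ → Tree → Tree → ℤ
mobF zero s t = + 0
mobF (suc k) s t =
  if eqᵇ s t then + 1
  else if leqᵇ s t
    then - sumℤ (map (mobF k s)
                 (filterᵇ (λ u → leqᵇ s u ∧ (leqᵇ u t ∧ not (eqᵇ u t))) (𝒴 (size s))))
    else + 0

μ : Tree → Tree → ℤ
μ s t = mobF (suc (wt s)) s t

-- Permutations in one-line notation (lists of values 1..n)

_/ₚ_ : List ℕ → List ℕ → List ℕ
σ /ₚ τ = σ ++ map (_+ length σ) τ

_∨ₚ_ : List ℕ → List ℕ → List ℕ
σ ∨ₚ τ = map (_+ length τ) σ ++ (length σ + length τ + 1) ∷ τ

γ : Tree → List ℕ
γ leaf = []
γ (node l r) = γ l ∨ₚ γ r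

-- standardization (of a word with distinct letters)
st : List ℕ → List ℕ
st σ = map (λ x → suc (length (filterᵇ (λ y → y <ᵇ x) σ))) σ

splitAtVal : ℕ → List ℕ → List ℕ × List ℕ
splitAtVal m [] = [] , []
splitAtVal m (x ∷ xs) =
  if x ≡ᵇ m then ([] , xs)
  else (x ∷ proj₁ (splitAtVal m xs) , proj₂ (splitAtVal m xs))

-- λ with fuel (fuel = length suffices: the pieces are strictly shorter)
λF : ℕ → List ℕ → Tree
λF zero σ = leaf
λF (suc k) [] = leaf
λF (suc k) (x ∷ xs) =
  node (λF k (st (proj₁ (splitAtVal (length (x ∷ xs)) (x ∷ xs)))))
       (λF k (st (proj₂ (splitAtVal (length (x ∷ xs)) (x ∷ xs)))))

λₚ : List ℕ → Tree
λₚ σ = λF (length σ) σ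

-- i-th letter, 1-indexed (0 if out of range)
at : List ℕ → ℕ → ℕ
at [] i = 0
at (x ∷ xs) zero = 0
at (x ∷ xs) (suc zero) = x
at (x ∷ xs) (suc (suc i)) = at xs (suc i)

-- 1-indexed position of the letter i (0 if absent)
posOf : ℕ → List ℕ → ℕ
posOf i [] = 0
posOf i (x ∷ xs) = if x ≡ᵇ i then 1 else (if posOf i xs ≡ᵇ 0 then 0 else suc (posOf i xs))

_·ₚ_ : List ℕ → List ℕ → List ℕ
σ ·ₚ ζ = map (at σ) ζ

inv : List ℕ → List ℕ
inv ζ = map (λ i → posOf (suc i) ζ) (upTo (length ζ))

insertAll : ℕ → List ℕ → List (List ℕ)
insertAll x [] = (x ∷ []) ∷ []
insertAll x (y ∷ ys) = (x ∷ y ∷ ys) ∷ map (y ∷_) (insertAll x ys)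

perms : ℕ → List (List ℕ)
perms zero = [] ∷ []
perms (suc n) = concatMap (insertAll (suc n)) (perms n)

increasing : List ℕ → Bool
increasing [] = true
increasing (x ∷ []) = true
increasing (x ∷ y ∷ ys) = (x <ᵇ y) ∧ increasing (y ∷ ys)

Sh : ℕ → ℕ → List (List ℕ)
Sh p q = filterᵇ (λ ζ → increasing (take p ζ) ∧ increasing (drop p ζ)) (perms (p + q))

-- 𝒴Sym: finite formal ℤ-linear combinations of the F-basis,
-- compared coefficientwise.

Lin : Set
Lin = List (ℤ × Tree)

coeffF : Lin → Tree → ℤ
coeffF a x = sumℤ (map (λ p → if eqᵇ (proj₂ p) x then proj₁ p else + 0) a)

scale : ℤ → Lin → Lin
scale c a = map (λ p → (c *ℤ proj₁ p , proj₂ p)) a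

prodF : Tree → Tree → Lin
prodF s t = map (λ ζ → (+ 1 , λₚ ((γ s /ₚ γ t) ·ₚ inv ζ))) (Sh (size s) (size t))

_⋆_ : Lin → Lin → Lin
a ⋆ b = concatMap (λ p → concatMap (λ q → scale (proj₁ p *ℤ proj₁ q) (prodF (proj₂ p) (proj₂ q))) b) a

M : Tree → Lin
M t = map (λ s → (μ t s , s)) (filterᵇ (leqᵇ t) (𝒴 (size t)))

data Sub : Tree → Set where
  sleaf : Sub leaf
  snode : ∀ {l r} → Bool → Sub l → Sub r → Sub (node l r)

subsets : (t : Tree) → List (Sub t)
subsets leaf = sleaf ∷ []
subsets (node l r) =
  concatMap (λ b → concatMap (λ S → map (snode b S) (subsets r)) (subsets l)) (true ∷ false ∷ [])

allIn : ∀ {t} → Sub t → Bool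
allIn sleaf = true
allIn (snode b S T) = b ∧ (allIn S ∧ allIn T)

admissible : ∀ {t} → Sub t → Bool
admissible sleaf = true
admissible (snode b S T) = (if b then allIn S else true) ∧ (admissible S ∧ admissible T)

_∖_ : Tree → Tree → Tree
leaf ∖ t = t
node a b ∖ t = node a (b ∖ t)

prune : ∀ {t} → Sub t → Tree × Tree
prune sleaf = leaf , leaf
prune {node s t} (snode true S T) = node s (proj₁ (prune T)) , proj₂ (prune T)
prune {node s t} (snode false S T) =
  (proj₁ (prune S) ∖ proj₁ (prune T)) , node (proj₂ (prune S)) (proj₂ (prune T))

count : Tree → Tree → Tree → ℕ
count t u v = length (filterᵇ (λ S → admissible S ∧ (eqᵇ (proj₁ (prune S)) u ∧ eqᵇ (proj₂ (prune S)) v))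
                             (subsets t))

rhs : Tree → Tree → Lin
rhs u v = concatMap (λ t → scale (+ count t u v) (M t)) (𝒴 (size u + size v))

{-# OPTIONS --safe #-}
-- Since F_x is the sum of the M_t with t ≥ x, Möbius inversion reduces the theorem to the following
-- count, for all trees a, b, t: the terms F_x of F_a · F_b with x ≤ t are as many as the admissible S
-- with a ≤ t'_S and b ≤ t''_S.
-- The maximal letter of a shuffle of γ(a) with γ(b) comes from the root of b = b_l ∨ b_r, so
-- F_a · F_b is the sum of (F_a' · F_b_l) ∨ (F_a'' · F_b_r) over the splittings of a at a leaf into
-- (a', a''). On the other side, x ∨ y ≤ t iff t can be written p \ (c ∨ d) with x ≤ p \ c and y ≤ d;
-- and the decompositions p \ (c ∨ d) of t''_S correspond to those of t together with admissible
-- subsets of p \ c and of d. Finally a ≤ p \ q iff a splits into a' ≤ p and a'' ≤ q, in which case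
-- it does so uniquely; hence both counts satisfy the same recursion in b.
module Submission where

open import Defs
open import Data.Nat using (ℕ; _+_)
open import Data.Product using (_×_)
open import Relation.Binary.PropositionalEquality using (_≡_; _≢_)

open import Data.Nat as ℕ using (zero; suc; s≤s; z≤n; _≡ᵇ_; _<ᵇ_)
import Data.Nat.Properties as ℕP
import Data.Nat.Tactic.RingSolver as ℕSolver
open import Data.Integer using (ℤ; +_; -_; _*_; _-_) renaming (_+_ to _+ℤ_)
import Data.Integer.Properties as ℤP
open import Data.Integer.Tactic.RingSolver using (solve-∀)
open import Algebra.Properties.AbelianGroup ℤP.+-0-abelianGroup using (∙-cancelʳ)
open import Algebra.Properties.CommutativeSemigroup ℤP.+-commutativeSemigroup using ()
  renaming (interchange to +-interchange; x∙yz≈y∙xz to +-swapˡ)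
open import Algebra.Properties.CommutativeSemigroup ℤP.*-commutativeSemigroup using ()
  renaming (interchange to *-interchange; x∙yz≈y∙xz to *-swapˡ)
open import Data.Bool using (Bool; true; false; _∧_; not; if_then_else_)
open import Data.Bool.Properties using (T-≡; ∧-zeroʳ; ∧-assoc)
open import Data.Empty using (⊥-elim)
open import Data.List using (List; []; _∷_; [_]; _++_; _∷ʳ_; map; concatMap; filterᵇ; length; take; drop; reverse; upTo)
open import Data.List.Properties using (map-++; map-∘; map-cong-local; length-++; length-map; length-reverse; length-take; take++drop≡id; upTo-∷ʳ; reverse-++; reverse-map; reverse-involutive; unfold-reverse; ++-assoc; ++-identityʳ)
open import Data.List.Membership.Propositional using (_∈_; find)
open import Data.List.Membership.Propositional.Properties using (∈-map⁺; ∈-map⁻; ∈-concatMap⁻; ∈-upTo⁻; ∈-++⁺ˡ; ∈-++⁺ʳ)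
open import Data.List.Relation.Unary.Any using (here; there)
open import Data.List.Relation.Unary.All as All using (All; []; _∷_)
import Data.List.Relation.Unary.All.Properties as AllP
open import Data.List.Relation.Binary.Permutation.Propositional using (_↭_; ↭-refl; ↭-sym; ↭-trans; ↭-reflexive; prep; swap)
open import Data.List.Relation.Binary.Permutation.Propositional.Properties using (All-resp-↭; ↭-empty-inv; ∈-resp-↭; ↭-length; ↭-reverse; shift; shifts; ++⁺; ++⁺ˡ)
open import Data.Product using (_,_; proj₁; proj₂; ∃; ∃₂; map₁)
open import Data.Sum using (_⊎_; inj₁; inj₂)
open import Function using (_∘_; Equivalence)
open import Relation.Nullary using (Dec; yes; no; does; ¬_)
open import Relation.Nullary.Decidable using (dec-true; dec-false)
open import Relation.Binary.Construct.Closure.ReflexiveTransitive using (ε; _◅_; _◅◅_; gmap)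
open import Relation.Binary.PropositionalEquality using (refl; sym; trans; cong; cong₂; subst; subst₂; module ≡-Reasoning)

open ≡-Reasoning

-- Multiplicities matter, so every correspondence is stated as an equality of sums over lists with
-- an arbitrary weight; decompositions then compose by exchanging sums and distributivity. For the
-- same reason the order enters as the integer `le`, a sum of products that can be expanded; that it
-- takes only the values 0 and 1 is proved later, by comparing sizes. The obstacle is that the
-- product is defined through inverse permutations, while `λₚ` searches for a maximal letter and
-- standardizes at each level. Reading them backwards turns that end into a head, and puts the
-- letters of the right subtree before those of the left one in `Decr`.

private variable
  A B : Set

-- Finite sums over lists and 0-1 indicators.

∑ : List A → (A → ℤ) → ℤ
∑ l f = sumℤ (map f l)

∑-cong-∈ : (l : List A) {f g : A → ℤ} → (∀ x → x ∈ l → f x ≡ g x) → ∑ l f ≡ ∑ l g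
∑-cong-∈ []      e = refl
∑-cong-∈ (x ∷ l) e = cong₂ _+ℤ_ (e x (here refl)) (∑-cong-∈ l (λ y m → e y (there m)))

∑-cong : (l : List A) {f g : A → ℤ} → (∀ x → f x ≡ g x) → ∑ l f ≡ ∑ l g
∑-cong l e = ∑-cong-∈ l (λ x _ → e x)

∑-++ : (l k : List A) (f : A → ℤ) → ∑ (l ++ k) f ≡ ∑ l f +ℤ ∑ k f
∑-++ []      k f = sym (ℤP.+-identityˡ _)
∑-++ (x ∷ l) k f = trans (cong (_+ℤ_ (f x)) (∑-++ l k f)) (sym (ℤP.+-assoc (f x) _ _))

∑-map : (l : List A) (g : A → B) (f : B → ℤ) → ∑ (map g l) f ≡ ∑ l (f ∘ g)
∑-map l g f = cong sumℤ (sym (map-∘ l))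

∑-concatMap : (l : List A) (g : A → List B) (f : B → ℤ) →
  ∑ (concatMap g l) f ≡ ∑ l (λ x → ∑ (g x) f)
∑-concatMap []      g f = refl
∑-concatMap (x ∷ l) g f = trans (∑-++ (g x) _ f) (cong (_+ℤ_ (∑ (g x) f)) (∑-concatMap l g f))

∑-zero : (l : List A) {f : A → ℤ} → (∀ x → x ∈ l → f x ≡ + 0) → ∑ l f ≡ + 0
∑-zero []      e = refl
∑-zero (x ∷ l) e = cong₂ _+ℤ_ (e x (here refl)) (∑-zero l (λ y m → e y (there m)))

∑-+ : (l : List A) (f g : A → ℤ) → ∑ l (λ x → f x +ℤ g x) ≡ ∑ l f +ℤ ∑ l g
∑-+ []      f g = refl
∑-+ (x ∷ l) f g = trans (cong (_+ℤ_ (f x +ℤ g x)) (∑-+ l f g)) (+-interchange (f x) (g x) (∑ l f) (∑ l g))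

∑-*ˡ : (l : List A) (c : ℤ) (f : A → ℤ) → c * ∑ l f ≡ ∑ l (λ x → c * f x)
∑-*ˡ []      c f = ℤP.*-zeroʳ c
∑-*ˡ (x ∷ l) c f = trans (ℤP.*-distribˡ-+ c (f x) _) (cong (_+ℤ_ (c * f x)) (∑-*ˡ l c f))

∑-*ʳ : (l : List A) (c : ℤ) (f : A → ℤ) → ∑ l f * c ≡ ∑ l (λ x → f x * c)
∑-*ʳ l c f = trans (ℤP.*-comm (∑ l f) c)
  (trans (∑-*ˡ l c f) (∑-cong l (λ x → ℤP.*-comm c (f x))))

∑-swap : (l : List A) (k : List B) (f : A → B → ℤ) →
  ∑ l (λ x → ∑ k (f x)) ≡ ∑ k (λ y → ∑ l (λ x → f x y))
∑-swap []      k f = sym (∑-zero k (λ _ _ → refl))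
∑-swap (x ∷ l) k f = trans (cong (_+ℤ_ (∑ k (f x))) (∑-swap l k f)) (sym (∑-+ k (f x) _))

∑-*-∑ : (l : List A) (k : List B) (f : A → ℤ) (g : B → ℤ) →
  ∑ l f * ∑ k g ≡ ∑ l (λ x → ∑ k (λ y → f x * g y))
∑-*-∑ l k f g = trans (∑-*ʳ l _ f) (∑-cong l (λ x → ∑-*ˡ k (f x) g))

⟦_⟧ : Bool → ℤ
⟦ true ⟧  = + 1
⟦ false ⟧ = + 0

⟦∧⟧ : ∀ b c → ⟦ b ∧ c ⟧ ≡ ⟦ b ⟧ * ⟦ c ⟧
⟦∧⟧ true  c = sym (ℤP.*-identityˡ ⟦ c ⟧)
⟦∧⟧ false c = refl

if-⟦⟧ : ∀ b c → (if b then c else + 0) ≡ ⟦ b ⟧ * c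
if-⟦⟧ true  c = sym (ℤP.*-identityˡ c)
if-⟦⟧ false c = refl

∑-filter : (p : A → Bool) (l : List A) (f : A → ℤ) →
  ∑ (filterᵇ p l) f ≡ ∑ l (λ x → ⟦ p x ⟧ * f x)
∑-filter p []      f = refl
∑-filter p (x ∷ l) f with p x
... | true  = cong₂ _+ℤ_ (sym (ℤP.*-identityˡ (f x))) (∑-filter p l f)
... | false = trans (∑-filter p l f) (sym (ℤP.+-identityˡ _))

length-filter : (p : A → Bool) (l : List A) → + length (filterᵇ p l) ≡ ∑ l (λ x → ⟦ p x ⟧)
length-filter p []      = refl
length-filter p (x ∷ l) with p x
... | true  = cong (_+ℤ_ (+ 1)) (length-filter p l)
... | false = trans (length-filter p l) (sym (ℤP.+-identityˡ _))

-- Spines, splittings and prunings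

-- The pairs (p ∖ c , d) with t = p ∖ (node c d).
spines : Tree → List (Tree × Tree)
spines leaf       = []
spines (node c d) = (c , d) ∷ map (map₁ (node c)) (spines d)

-- The indicator of s ≤T t (see le-≤T?), by recursion on s.
le : Tree → Tree → ℤ
le leaf       leaf       = + 1
le leaf       (node _ _) = + 0
le (node x y) t          = ∑ (spines t) (λ (P , d) → le x P * le y d)

-- The spine of the grafted tree is that of `p` followed by that of `q`: a cut at a node of `q`
-- keeps `p` in the left part, a cut at a node of `p` leaves `q` in the right part.
∑-spines-∖ : ∀ p q (f : Tree × Tree → ℤ) →
  ∑ (spines (p ∖ q)) f ≡
    ∑ (spines q) (λ (P , d) → f (p ∖ P , d)) +ℤ ∑ (spines p) (λ (P , d) → f (P , d ∖ q))
∑-spines-∖ leaf       q f = sym (ℤP.+-identityʳ _)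
∑-spines-∖ (node c e) q f = begin
  f (c , e ∖ q) +ℤ ∑ (map (map₁ (node c)) (spines (e ∖ q))) f
    ≡⟨ cong (_+ℤ_ (f (c , e ∖ q))) (trans (∑-map (spines (e ∖ q)) (map₁ (node c)) f)
         (∑-spines-∖ e q (f ∘ map₁ (node c)))) ⟩
  f (c , e ∖ q) +ℤ (X +ℤ ∑ (spines e) (λ (P , d) → f (node c P , d ∖ q)))
    ≡⟨ +-swapˡ (f (c , e ∖ q)) X _ ⟩
  X +ℤ (f (c , e ∖ q) +ℤ ∑ (spines e) (λ (P , d) → f (node c P , d ∖ q)))
    ≡⟨ cong (λ z → X +ℤ (f (c , e ∖ q) +ℤ z)) (sym (∑-map (spines e) (map₁ (node c)) _)) ⟩
  X +ℤ ∑ (spines (node c e)) (λ (P , d) → f (P , d ∖ q)) ∎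
  where
  X = ∑ (spines q) (λ (P , d) → f (node c (e ∖ P) , d))

-- One pair for each leaf: a node goes to the second tree if the leaf is in its left subtree; the
-- path from the leaf to the root separates the two pieces.
splits : Tree → List (Tree × Tree)
splits leaf       = (leaf , leaf) ∷ []
splits (node l r) = map (λ (l' , l'') → l' , node l'' r) (splits l)
                 ++ map (map₁ (node l)) (splits r)

∑-splits-node : ∀ l r (f : Tree × Tree → ℤ) → ∑ (splits (node l r)) f ≡
  ∑ (splits l) (λ (l' , l'') → f (l' , node l'' r)) +ℤ ∑ (splits r) (λ (r' , r'') → f (node l r' , r''))
∑-splits-node l r f = trans (∑-++ (map _ (splits l)) _ f)
  (cong₂ _+ℤ_ (∑-map (splits l) _ f) (∑-map (splits r) _ f))

-- The root of `a` is matched with a spine node of `q` or of `p`. In the first case it belongs to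
-- the second piece, so the splitting leaf lies in `x`; in the second case the leaf lies in `y`.
∑-splits-le : ∀ a p q → ∑ (splits a) (λ (a' , a'') → le a' p * le a'' q) ≡ le a (p ∖ q)
∑-splits-le leaf leaf       leaf       = refl
∑-splits-le leaf leaf       (node _ _) = refl
∑-splits-le leaf (node _ _) leaf       = refl
∑-splits-le leaf (node _ _) (node _ _) = refl
∑-splits-le (node x y) p q = begin
  ∑ (splits (node x y)) (λ (a' , a'') → le a' p * le a'' q)
    ≡⟨ ∑-splits-node x y _ ⟩
  ∑ (splits x) (λ (x' , x'') → le x' p * ∑ (spines q) (λ (P , d) → le x'' P * le y d))
    +ℤ ∑ (splits y) (λ (y' , y'') → ∑ (spines p) (λ (P , d) → le x P * le y' d) * le y'' q)
    ≡⟨ cong₂ _+ℤ_ left right ⟩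
  ∑ (spines q) (λ (P , d) → le x (p ∖ P) * le y d) +ℤ ∑ (spines p) (λ (P , d) → le x P * le y (d ∖ q))
    ≡⟨ ∑-spines-∖ p q _ ⟨
  le (node x y) (p ∖ q) ∎
  where
  left : ∑ (splits x) (λ (x' , x'') → le x' p * ∑ (spines q) (λ (P , d) → le x'' P * le y d))
         ≡ ∑ (spines q) (λ (P , d) → le x (p ∖ P) * le y d)
  left = begin
    _ ≡⟨ ∑-cong (splits x) (λ (x' , x'') → trans (∑-*ˡ (spines q) (le x' p) _)
           (∑-cong (spines q) (λ (P , d) → sym (ℤP.*-assoc (le x' p) (le x'' P) (le y d))))) ⟩
    _ ≡⟨ ∑-swap (splits x) (spines q) _ ⟩
    _ ≡⟨ ∑-cong (spines q) (λ (P , d) → trans (sym (∑-*ʳ (splits x) (le y d) _))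
           (cong (_* le y d) (∑-splits-le x p P))) ⟩
    _ ∎
  right : ∑ (splits y) (λ (y' , y'') → ∑ (spines p) (λ (P , d) → le x P * le y' d) * le y'' q)
          ≡ ∑ (spines p) (λ (P , d) → le x P * le y (d ∖ q))
  right = begin
    _ ≡⟨ ∑-cong (splits y) (λ (y' , y'') → trans (∑-*ʳ (spines p) (le y'' q) _)
           (∑-cong (spines p) (λ (P , d) → ℤP.*-assoc (le x P) (le y' d) (le y'' q)))) ⟩
    _ ≡⟨ ∑-swap (splits y) (spines p) _ ⟩
    _ ≡⟨ ∑-cong (spines p) (λ (P , d) → trans (sym (∑-*ˡ (splits y) (le x P) _))
           (cong (le x P *_) (∑-splits-le y d q))) ⟩
    _ ∎

∖-assoc : ∀ a b c → (a ∖ b) ∖ c ≡ a ∖ (b ∖ c)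
∖-assoc leaf       b c = refl
∖-assoc (node x y) b c = cong (node x) (∖-assoc y b c)

-- The pairs `prune S` for admissible `S` (see `∑-admissible`). A pruned root takes its whole left
-- subtree along, which leaves a choice only in `d`.
prunings : Tree → List (Tree × Tree)
prunings leaf       = (leaf , leaf) ∷ []
prunings (node c d) = map (map₁ (node c)) (prunings d)
  ++ concatMap (λ (s' , s'') → map (λ (p , q) → s' ∖ p , node s'' q) (prunings d)) (prunings c)

∑-prunings-node : ∀ c d (f : Tree × Tree → ℤ) → ∑ (prunings (node c d)) f ≡
  ∑ (prunings d) (λ (p , q) → f (node c p , q))
  +ℤ ∑ (prunings c) (λ (s' , s'') → ∑ (prunings d) (λ (p , q) → f (s' ∖ p , node s'' q)))
∑-prunings-node c d f = trans (∑-++ (map _ (prunings d)) _ f) (cong₂ _+ℤ_ (∑-map (prunings d) _ f)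
  (trans (∑-concatMap (prunings c) _ f) (∑-cong (prunings c) (λ _ → ∑-map (prunings d) _ f))))

-- The spine of the remaining tree consists of the spine nodes of `t` outside the subset. Cutting
-- `t` at such a node separates the subset into admissible subsets of the two parts, and the pruned
-- pieces of the left part come before those of the right part.
∑-prunings-spines : ∀ t (f : Tree → Tree × Tree → ℤ) →
  ∑ (prunings t) (λ (p , q) → ∑ (spines q) (f p)) ≡
  ∑ (spines t) (λ (P , e) → ∑ (prunings P) (λ (p₁ , q₁) → ∑ (prunings e) (λ (p₂ , q₂) →
    f (p₁ ∖ p₂) (q₁ , q₂))))
∑-prunings-spines leaf       f = refl
∑-prunings-spines (node c d) f = begin
  ∑ (prunings (node c d)) (λ (p , q) → ∑ (spines q) (f p))
    ≡⟨ ∑-prunings-node c d _ ⟩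
  ∑ (prunings d) (λ (p , q) → ∑ (spines q) (f (node c p)))
    +ℤ ∑ (prunings c) (λ (s' , s'') → ∑ (prunings d) (λ (p , q) → ∑ (spines (node s'' q)) (f (s' ∖ p))))
    ≡⟨ cong₂ _+ℤ_ (∑-prunings-spines d (λ p → f (node c p))) keep ⟩
  X +ℤ (Y +ℤ ∑ (spines d) (λ (P , e) → Z P e))
    ≡⟨ +-swapˡ X Y _ ⟩
  Y +ℤ (X +ℤ ∑ (spines d) (λ (P , e) → Z P e))
    ≡⟨ cong (_+ℤ_ Y) (sym cut) ⟩
  Y +ℤ ∑ (map (map₁ (node c)) (spines d)) (λ (P , e) → G P e) ∎
  where
  G : Tree → Tree → ℤ
  G P e = ∑ (prunings P) (λ (p₁ , q₁) → ∑ (prunings e) (λ (p₂ , q₂) → f (p₁ ∖ p₂) (q₁ , q₂)))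
  -- `X`: the root is pruned. `Y`: the root is kept and is the cutting node. `Z`: the root is kept
  -- and the cut is further along the spine.
  X = ∑ (spines d) (λ (P , e) → ∑ (prunings P) (λ (p₁ , q₁) → ∑ (prunings e) (λ (p₂ , q₂) →
        f (node c (p₁ ∖ p₂)) (q₁ , q₂))))
  Y = G c d
  Z : Tree → Tree → ℤ
  Z P e = ∑ (prunings c) (λ (s' , s'') → ∑ (prunings P) (λ (p₁ , q₁) → ∑ (prunings e) (λ (p₂ , q₂) →
        f (s' ∖ (p₁ ∖ p₂)) (node s'' q₁ , q₂))))
  keep : ∑ (prunings c) (λ (s' , s'') → ∑ (prunings d) (λ (p , q) → ∑ (spines (node s'' q)) (f (s' ∖ p))))
         ≡ Y +ℤ ∑ (spines d) (λ (P , e) → Z P e)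
  keep = begin
    _ ≡⟨ ∑-cong (prunings c) (λ (s' , s'') → trans
           (∑-cong (prunings d) (λ (p , q) → cong (_+ℤ_ (f (s' ∖ p) (s'' , q)))
             (∑-map (spines q) (map₁ (node s'')) (f (s' ∖ p)))))
           (∑-+ (prunings d) _ _)) ⟩
    _ ≡⟨ ∑-+ (prunings c) _ _ ⟩
    _ ≡⟨ cong (_+ℤ_ Y) (∑-cong (prunings c) (λ (s' , s'') →
           ∑-prunings-spines d (λ p (Q , e) → f (s' ∖ p) (node s'' Q , e)))) ⟩
    _ ≡⟨ cong (_+ℤ_ Y) (∑-swap (prunings c) (spines d) _) ⟩
    _ ∎
  cut : ∑ (map (map₁ (node c)) (spines d)) (λ (P , e) → G P e) ≡ X +ℤ ∑ (spines d) (λ (P , e) → Z P e)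
  cut = begin
    _ ≡⟨ ∑-map (spines d) _ _ ⟩
    _ ≡⟨ ∑-cong (spines d) (λ (P , e) → trans (∑-prunings-node c P _) (cong (_+ℤ_ (∑ (prunings P) (λ (p₁ , q₁) →
             ∑ (prunings e) (λ (p₂ , q₂) → f (node c (p₁ ∖ p₂)) (q₁ , q₂)))))
           (∑-cong (prunings c) (λ (s' , s'') → ∑-cong (prunings P) (λ (p₁ , q₁) →
             ∑-cong (prunings e) (λ (p₂ , q₂) → cong (λ w → f w (node s'' q₁ , q₂)) (∖-assoc s' p₁ p₂))))))) ⟩
    _ ≡⟨ ∑-+ (spines d) _ _ ⟩
    _ ∎

-- A kept root survives in the second component, so only the full subset contributes.
∑-prunings-leaf : ∀ t (g : Tree → ℤ) → ∑ (prunings t) (λ (p , q) → g p * le leaf q) ≡ g t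
∑-prunings-leaf leaf       g = trans (ℤP.+-identityʳ _) (ℤP.*-identityʳ (g leaf))
∑-prunings-leaf (node c d) g = begin
  _ ≡⟨ ∑-prunings-node c d _ ⟩
  _ ≡⟨ cong₂ _+ℤ_ (∑-prunings-leaf d (g ∘ node c)) (∑-zero (prunings c) (λ (s' , _) _ →
         ∑-zero (prunings d) (λ (p , _) _ → ℤP.*-zeroʳ (g (s' ∖ p))))) ⟩
  _ ≡⟨ ℤP.+-identityʳ _ ⟩
  _ ∎

-- The terms of F_a · F_b with multiplicity, computed on trees alone; `∑-prodF` compares this with
-- the definition by permutations.
shuffles : Tree → Tree → List Tree
shuffles a leaf       = a ∷ []
shuffles a (node l r) = concatMap (λ (a' , a'') →
  concatMap (λ x → map (node x) (shuffles a'' r)) (shuffles a' l)) (splits a)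

∑-shuffles-node : ∀ a l r (f : Tree → ℤ) → ∑ (shuffles a (node l r)) f ≡
  ∑ (splits a) (λ (a' , a'') → ∑ (shuffles a' l) (λ x → ∑ (shuffles a'' r) (λ y → f (node x y))))
∑-shuffles-node a l r f = trans (∑-concatMap (splits a) _ f) (∑-cong (splits a) (λ (a' , a'') →
  trans (∑-concatMap (shuffles a' l) _ f) (∑-cong (shuffles a' l) (λ x → ∑-map (shuffles a'' r) (node x) f))))

-- Induction on `b` for all `a` at once, because the recursive calls concern the pieces of `a`.
∑-shuffles-le : ∀ a b t →
  ∑ (shuffles a b) (λ x → le x t) ≡ ∑ (prunings t) (λ (p , q) → le a p * le b q)
∑-shuffles-le a leaf       t = trans (ℤP.+-identityʳ _) (sym (∑-prunings-leaf t (le a)))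
∑-shuffles-le a (node l r) t = begin
  ∑ (shuffles a (node l r)) (λ x → le x t)
    ≡⟨ ∑-shuffles-node a l r _ ⟩
  ∑ (splits a) (λ (a' , a'') → ∑ (shuffles a' l) (λ x → ∑ (shuffles a'' r) (λ y →
    ∑ (spines t) (λ (P , e) → le x P * le y e))))
    ≡⟨ ∑-cong (splits a) (λ (a' , a'') → trans
         (∑-cong (shuffles a' l) (λ x → ∑-swap (shuffles a'' r) (spines t) _))
         (∑-swap (shuffles a' l) (spines t) _)) ⟩
  ∑ (splits a) (λ (a' , a'') → ∑ (spines t) (λ (P , e) → ∑ (shuffles a' l) (λ x →
    ∑ (shuffles a'' r) (λ y → le x P * le y e))))
    ≡⟨ ∑-cong (splits a) (λ (a' , a'') → ∑-cong (spines t) (λ (P , e) → trans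
         (sym (∑-*-∑ (shuffles a' l) (shuffles a'' r) _ _))
         (trans (cong₂ _*_ (∑-shuffles-le a' l P) (∑-shuffles-le a'' r e))
         (∑-*-∑ (prunings P) (prunings e) _ _)))) ⟩
  ∑ (splits a) (λ (a' , a'') → ∑ (spines t) (λ (P , e) → ∑ (prunings P) (λ (p₁ , q₁) →
    ∑ (prunings e) (λ (p₂ , q₂) → (le a' p₁ * le l q₁) * (le a'' p₂ * le r q₂)))))
    ≡⟨ ∑-swap (splits a) (spines t) _ ⟩
  -- The sum over splittings moves innermost, where `∑-splits-le` merges the conditions on the two
  -- pieces into one on `a`.
  _ ≡⟨ ∑-cong (spines t) (λ (P , e) → trans (∑-swap (splits a) (prunings P) _)
         (∑-cong (prunings P) (λ (p₁ , q₁) → trans (∑-swap (splits a) (prunings e) _)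
         (∑-cong (prunings e) (λ (p₂ , q₂) → collect p₁ q₁ p₂ q₂))))) ⟩
  ∑ (spines t) (λ (P , e) → ∑ (prunings P) (λ (p₁ , q₁) → ∑ (prunings e) (λ (p₂ , q₂) →
    le a (p₁ ∖ p₂) * (le l q₁ * le r q₂))))
    ≡⟨ ∑-prunings-spines t (λ p (Q , e) → le a p * (le l Q * le r e)) ⟨
  ∑ (prunings t) (λ (p , q) → ∑ (spines q) (λ (Q , e) → le a p * (le l Q * le r e)))
    ≡⟨ ∑-cong (prunings t) (λ (p , q) → sym (∑-*ˡ (spines q) (le a p) _)) ⟩
  ∑ (prunings t) (λ (p , q) → le a p * le (node l r) q) ∎
  where
  collect : ∀ p₁ q₁ p₂ q₂ →
    ∑ (splits a) (λ (a' , a'') → (le a' p₁ * le l q₁) * (le a'' p₂ * le r q₂))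
    ≡ le a (p₁ ∖ p₂) * (le l q₁ * le r q₂)
  collect p₁ q₁ p₂ q₂ = begin
    _ ≡⟨ ∑-cong (splits a) (λ (a' , a'') → *-interchange (le a' p₁) (le l q₁) (le a'' p₂) (le r q₂)) ⟩
    _ ≡⟨ ∑-*ʳ (splits a) (le l q₁ * le r q₂) _ ⟨
    _ ≡⟨ cong (_* (le l q₁ * le r q₂)) (∑-splits-le a p₁ p₂) ⟩
    _ ∎

-- Shuffles of words

wordSplits : List ℕ → List (List ℕ × List ℕ)
wordSplits []      = ([] , []) ∷ []
wordSplits (x ∷ w) = ([] , x ∷ w) ∷ map (map₁ (x ∷_)) (wordSplits w)

∑-wordSplits-∷ : ∀ x w (F : List ℕ × List ℕ → ℤ) →
  ∑ (wordSplits (x ∷ w)) F ≡ F ([] , x ∷ w) +ℤ ∑ (wordSplits w) (λ (u , v) → F (x ∷ u , v))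
∑-wordSplits-∷ x w F = cong (_+ℤ_ (F ([] , x ∷ w))) (∑-map (wordSplits w) _ F)

∑-wordSplits-++∷ : ∀ w₂ m w₁ (F : List ℕ × List ℕ → ℤ) → ∑ (wordSplits (w₂ ++ m ∷ w₁)) F ≡
  ∑ (wordSplits w₂) (λ (u , v) → F (u , v ++ m ∷ w₁)) +ℤ ∑ (wordSplits w₁) (λ (u , v) → F (w₂ ++ m ∷ u , v))
∑-wordSplits-++∷ []       m w₁ F = trans (∑-wordSplits-∷ m w₁ F)
  (cong (_+ℤ ∑ (wordSplits w₁) (λ (u , v) → F (m ∷ u , v))) (sym (ℤP.+-identityʳ (F ([] , m ∷ w₁)))))
∑-wordSplits-++∷ (x ∷ w₂) m w₁ F = begin
  _ ≡⟨ ∑-wordSplits-∷ x (w₂ ++ m ∷ w₁) F ⟩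
  _ ≡⟨ cong (_+ℤ_ (F ([] , x ∷ w₂ ++ m ∷ w₁))) (∑-wordSplits-++∷ w₂ m w₁ (F ∘ map₁ (x ∷_))) ⟩
  _ ≡⟨ ℤP.+-assoc (F ([] , x ∷ w₂ ++ m ∷ w₁)) _ _ ⟨
  _ ≡⟨ cong (_+ℤ ∑ (wordSplits w₁) (λ (u , v) → F (x ∷ w₂ ++ m ∷ u , v)))
         (sym (∑-wordSplits-∷ x w₂ (λ (u , v) → F (u , v ++ m ∷ w₁)))) ⟩
  _ ∎

wordShuffles : List ℕ → List ℕ → List (List ℕ)
wordShuffles []       ys       = ys ∷ []
wordShuffles (x ∷ xs) []       = (x ∷ xs) ∷ []
wordShuffles (x ∷ xs) (y ∷ ys) =
  map (x ∷_) (wordShuffles xs (y ∷ ys)) ++ map (y ∷_) (wordShuffles (x ∷ xs) ys)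

∑-wordShuffles-[] : ∀ w (F : List ℕ → ℤ) → ∑ (wordShuffles w []) F ≡ F w
∑-wordShuffles-[] []      F = ℤP.+-identityʳ _
∑-wordShuffles-[] (x ∷ w) F = ℤP.+-identityʳ _

∑-wordShuffles-∷ : ∀ x xs y ys (F : List ℕ → ℤ) → ∑ (wordShuffles (x ∷ xs) (y ∷ ys)) F ≡
  ∑ (wordShuffles xs (y ∷ ys)) (F ∘ (x ∷_)) +ℤ ∑ (wordShuffles (x ∷ xs) ys) (F ∘ (y ∷_))
∑-wordShuffles-∷ x xs y ys F = trans (∑-++ (map (x ∷_) (wordShuffles xs (y ∷ ys))) _ F)
  (cong₂ _+ℤ_ (∑-map (wordShuffles xs (y ∷ ys)) _ F) (∑-map (wordShuffles (x ∷ xs) ys) _ F))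

-- A shuffle is cut at the letter `m` of the second word: a prefix of `w` is shuffled with `w₂`
-- before it, the remaining suffix with `w₁` after it.
∑-wordShuffles-++∷ : ∀ w w₂ m w₁ (F : List ℕ → ℤ) → ∑ (wordShuffles w (w₂ ++ m ∷ w₁)) F ≡
  ∑ (wordSplits w) (λ (u , v) → ∑ (wordShuffles u w₂) (λ z₂ → ∑ (wordShuffles v w₁) (λ z₁ →
    F (z₂ ++ m ∷ z₁))))
∑-wordShuffles-++∷ []      w₂ m w₁ F = lemma (F (w₂ ++ m ∷ w₁))
  where
  lemma : ∀ a → a +ℤ + 0 ≡ a +ℤ + 0 +ℤ + 0 +ℤ + 0
  lemma = solve-∀
∑-wordShuffles-++∷ (x ∷ w) [] m w₁ F = begin
  _ ≡⟨ ∑-wordShuffles-∷ x w m w₁ F ⟩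
  ∑ (wordShuffles w (m ∷ w₁)) (F ∘ (x ∷_)) +ℤ X
    ≡⟨ cong (_+ℤ X) (∑-wordShuffles-++∷ w [] m w₁ (F ∘ (x ∷_))) ⟩
  _ ≡⟨ ℤP.+-comm _ X ⟩
  _ ≡⟨ cong₂ _+ℤ_ (sym (ℤP.+-identityʳ X)) (∑-cong (wordSplits w) (λ (u , v) →
         trans (∑-wordShuffles-[] u _) (sym (∑-wordShuffles-[] (x ∷ u) (inner v))))) ⟩
  _ ≡⟨ ∑-wordSplits-∷ x w (λ (u , v) → ∑ (wordShuffles u []) (inner v)) ⟨
  _ ∎
  where
  inner : List ℕ → List ℕ → ℤ
  inner v z₂ = ∑ (wordShuffles v w₁) (λ z₁ → F (z₂ ++ m ∷ z₁))
  X = ∑ (wordShuffles (x ∷ w) w₁) (F ∘ (m ∷_))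
∑-wordShuffles-++∷ (x ∷ w) (y ∷ w₂) m w₁ F = begin
  _ ≡⟨ ∑-wordShuffles-∷ x w y (w₂ ++ m ∷ w₁) F ⟩
  _ ≡⟨ cong₂ _+ℤ_ (∑-wordShuffles-++∷ w (y ∷ w₂) m w₁ (F ∘ (x ∷_)))
         (trans (∑-wordShuffles-++∷ (x ∷ w) w₂ m w₁ (F ∘ (y ∷_))) (∑-wordSplits-∷ x w
           (λ (u , v) → ∑ (wordShuffles u w₂) (inner v ∘ (y ∷_))))) ⟩
  X +ℤ (Y +ℤ Z) ≡⟨ +-swapˡ X Y Z ⟩
  Y +ℤ (X +ℤ Z) ≡⟨ cong (_+ℤ_ Y) (trans (sym (∑-+ (wordSplits w) _ _))
                   (∑-cong (wordSplits w) (λ (u , v) → sym (∑-wordShuffles-∷ x u y w₂ (inner v))))) ⟩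
  _ ≡⟨ ∑-wordSplits-∷ x w (λ (u , v) → ∑ (wordShuffles u (y ∷ w₂)) (inner v)) ⟨
  _ ∎
  where
  inner : List ℕ → List ℕ → ℤ
  inner v z₂ = ∑ (wordShuffles v w₁) (λ z₁ → F (z₂ ++ m ∷ z₁))
  X = ∑ (wordSplits w) (λ (u , v) → ∑ (wordShuffles u (y ∷ w₂)) (λ z₂ → inner v (x ∷ z₂)))
  Y = ∑ (wordShuffles [] w₂) (λ z₂ → inner (x ∷ w) (y ∷ z₂))
  Z = ∑ (wordSplits w) (λ (u , v) → ∑ (wordShuffles (x ∷ u) w₂) (λ z₂ → inner v (y ∷ z₂)))

-- Decr w t: the word w, read backwards, has decreasing tree t.
data Decr : List ℕ → Tree → Set where
  leaf : Decr [] leaf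
  node : ∀ {w₁ w₂ m t₁ t₂} → All (ℕ._< m) w₁ → All (ℕ._< m) w₂ → Decr w₁ t₁ → Decr w₂ t₂ →
         Decr (w₂ ++ m ∷ w₁) (node t₁ t₂)

-- Gaps between letters correspond to leaves of the decreasing tree. Since `w` is read backwards,
-- the suffix `v` carries the left piece `a'`, and gaps in `w₂` are leaves of the right subtree.
∑-wordSplits-splits : ∀ {w a} → Decr w a → (F : List ℕ × List ℕ → ℤ) (f : Tree × Tree → ℤ) →
  (∀ u v {a' a''} → u ++ v ≡ w → Decr v a' → Decr u a'' → F (u , v) ≡ f (a' , a'')) →
  ∑ (wordSplits w) F ≡ ∑ (splits a) f
∑-wordSplits-splits leaf F f h = cong (_+ℤ + 0) (h [] [] refl leaf leaf)
∑-wordSplits-splits (node {w₁} {w₂} {m} {t₁} {t₂} lt₁ lt₂ d₁ d₂) F f h = begin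
  _ ≡⟨ ∑-wordSplits-++∷ w₂ m w₁ F ⟩
  _ ≡⟨ cong₂ _+ℤ_
         (∑-wordSplits-splits d₂ _ (λ (r' , r'') → f (node t₁ r' , r'')) (λ u v e dv du →
           h u (v ++ m ∷ w₁) (trans (sym (++-assoc u v _)) (cong (_++ m ∷ w₁) e))
             (node lt₁ (AllP.++⁻ʳ u (subst (All _) (sym e) lt₂)) d₁ dv) du))
         (∑-wordSplits-splits d₁ _ (λ (l' , l'') → f (l' , node l'' t₂)) (λ u v e dv du →
           h (w₂ ++ m ∷ u) v (trans (++-assoc w₂ (m ∷ u) v) (cong (λ z → w₂ ++ m ∷ z) e))
             dv (node (AllP.++⁻ˡ u (subst (All _) (sym e) lt₁)) lt₂ du d₂))) ⟩
  _ ≡⟨ ℤP.+-comm (∑ (splits t₂) (λ (r' , r'') → f (node t₁ r' , r''))) _ ⟩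
  _ ≡⟨ ∑-splits-node t₁ t₂ f ⟨
  _ ∎

↭-interchange : ∀ u v w₂ (m : ℕ) w₁ → (u ++ w₂) ++ m ∷ (v ++ w₁) ↭ (u ++ v) ++ (w₂ ++ m ∷ w₁)
↭-interchange u v w₂ m w₁ = ↭-trans (↭-reflexive (++-assoc u w₂ _)) (↭-trans
  (++⁺ˡ u (↭-trans (++⁺ˡ w₂ (↭-sym (shift m v w₁))) (shifts w₂ v)))
  (↭-reflexive (sym (++-assoc u v _))))

-- The letters of `w'` exceed those of `w`, so the maximum of a shuffle is that of `w'`, and cutting
-- there follows the recursion of `shuffles`. Comparing the weights on permutations of `w ++ w'`
-- tells the caller which letters occur in `z`.
∑-wordShuffles-shuffles : ∀ {w w' a b} → Decr w a → Decr w' b → All (λ y → All (ℕ._< y) w) w' →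
  (F : List ℕ → ℤ) (f : Tree → ℤ) → (∀ z {t} → z ↭ w ++ w' → Decr z t → F z ≡ f t) →
  ∑ (wordShuffles w w') F ≡ ∑ (shuffles a b) f
∑-wordShuffles-shuffles {w} da leaf lt F f h =
  trans (∑-wordShuffles-[] w F) (trans (h w (↭-reflexive (sym (++-identityʳ w))) da) (sym (ℤP.+-identityʳ _)))
∑-wordShuffles-shuffles {w} {a = a} da (node {w₁} {w₂} {m} {b₁} {b₂} lt₁ lt₂ d₁ d₂) lt F f h = begin
  _ ≡⟨ ∑-wordShuffles-++∷ w w₂ m w₁ F ⟩
  _ ≡⟨ ∑-wordSplits-splits da _ _ step ⟩
  _ ≡⟨ ∑-shuffles-node a b₁ b₂ f ⟨
  _ ∎
  where
  lt-m : All (ℕ._< m) w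
  lt-m = All.head (AllP.++⁻ʳ w₂ lt)
  step : ∀ u v {a' a''} → u ++ v ≡ w → Decr v a' → Decr u a'' →
    ∑ (wordShuffles u w₂) (λ z₂ → ∑ (wordShuffles v w₁) (λ z₁ → F (z₂ ++ m ∷ z₁)))
    ≡ ∑ (shuffles a' b₁) (λ x → ∑ (shuffles a'' b₂) (λ y → f (node x y)))
  step u v {a'} {a''} e dv du = trans
    -- The part before `m` builds the right subtree, hence the outer sum over `y` and the final
    -- exchange.
    (∑-wordShuffles-shuffles du d₂ (All.map (AllP.++⁻ˡ u ∘ split) (AllP.++⁻ˡ w₂ lt)) _
      (λ y → ∑ (shuffles a' b₁) (λ x → f (node x y))) (λ z₂ p₂ dz₂ →
        ∑-wordShuffles-shuffles dv d₁
          (All.map (AllP.++⁻ʳ u ∘ split) (All.tail (AllP.++⁻ʳ w₂ lt))) _ _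
          (λ z₁ p₁ dz₁ → h (z₂ ++ m ∷ z₁)
            (↭-trans (++⁺ p₂ (prep m p₁))
              (subst (λ z → (u ++ w₂) ++ m ∷ (v ++ w₁) ↭ z ++ (w₂ ++ m ∷ w₁)) e (↭-interchange u v w₂ m w₁)))
            (node (All-resp-↭ (↭-sym p₁) (AllP.++⁺ (AllP.++⁻ʳ u (split lt-m)) lt₁))
                  (All-resp-↭ (↭-sym p₂) (AllP.++⁺ (AllP.++⁻ˡ u (split lt-m)) lt₂)) dz₁ dz₂))))
    (∑-swap (shuffles a'' b₂) (shuffles a' b₁) _)
    where
    split : ∀ {P : ℕ → Set} → All P w → All P (u ++ v)
    split = subst (All _) (sym e)

-- Standardization and decreasing trees

rank : List ℕ → ℕ → ℕ
rank σ x = suc (length (filterᵇ (λ y → y <ᵇ x) σ))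

<ᵇ-true : ∀ {m n} → m ℕ.< n → (m <ᵇ n) ≡ true
<ᵇ-true {m} {n} = dec-true (m ℕ.<? n)

<ᵇ-false : ∀ {m n} → n ℕ.≤ m → (m <ᵇ n) ≡ false
<ᵇ-false {m} {n} p = dec-false (m ℕ.<? n) (ℕP.≤⇒≯ p)

<ᵇ-sound : ∀ {m n} → (m <ᵇ n) ≡ true → m ℕ.< n
<ᵇ-sound {m} {n} e with m ℕ.<? n
... | yes p = p
... | no np with () ← trans (sym e) (dec-false (m ℕ.<? n) np)

module _ {A : Set} {p q : A → Bool} (imp : ∀ z → p z ≡ true → q z ≡ true) where

  length-filter-mono-≤ : ∀ l → length (filterᵇ p l) ℕ.≤ length (filterᵇ q l)
  length-filter-mono-≤ []      = z≤n
  length-filter-mono-≤ (x ∷ l) with p x in ep | q x in eq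
  ... | true  | true  = s≤s (length-filter-mono-≤ l)
  ... | true  | false with () ← trans (sym eq) (imp x ep)
  ... | false | true  = ℕP.m≤n⇒m≤1+n (length-filter-mono-≤ l)
  ... | false | false = length-filter-mono-≤ l

  length-filter-mono-< : ∀ {l y} → y ∈ l → p y ≡ false → q y ≡ true →
    length (filterᵇ p l) ℕ.< length (filterᵇ q l)
  length-filter-mono-< {x ∷ l} (here refl) py qy rewrite py | qy = s≤s (length-filter-mono-≤ l)
  length-filter-mono-< {x ∷ l} (there m) py qy with p x in ep | q x in eq
  ... | true  | true  = s≤s (length-filter-mono-< m py qy)
  ... | true  | false with () ← trans (sym eq) (imp x ep)
  ... | false | true  = ℕP.m≤n⇒m≤1+n (length-filter-mono-< m py qy)
  ... | false | false = length-filter-mono-< m py qy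

rank-mono-≤ : ∀ σ {x y} → x ℕ.≤ y → rank σ x ℕ.≤ rank σ y
rank-mono-≤ σ p = s≤s (length-filter-mono-≤ (λ z e → <ᵇ-true (ℕP.<-≤-trans (<ᵇ-sound e) p)) σ)

rank-mono-< : ∀ σ {x y} → x ∈ σ → x ℕ.< y → rank σ x ℕ.< rank σ y
rank-mono-< σ {x} x∈ p = s≤s (length-filter-mono-< (λ z e → <ᵇ-true (ℕP.<-trans (<ᵇ-sound e) p)) x∈
  (<ᵇ-false {x} ℕP.≤-refl) (<ᵇ-true p))

rank-<ᵇ : ∀ σ {x y} → x ∈ σ → (rank σ x <ᵇ rank σ y) ≡ (x <ᵇ y)
rank-<ᵇ σ {x} {y} x∈ with x ℕ.<? y
... | yes p = trans (<ᵇ-true (rank-mono-< σ x∈ p)) (sym (<ᵇ-true p))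
... | no np = trans (<ᵇ-false (rank-mono-≤ σ (ℕP.≮⇒≥ np))) (sym (<ᵇ-false (ℕP.≮⇒≥ np)))

-- Standardization only sees comparisons. This absorbs the first of two standardizations when `λF`
-- standardizes a piece of a standardized word.
st-map : ∀ (g : ℕ → ℕ) v → (∀ x y → x ∈ v → (g x <ᵇ g y) ≡ (x <ᵇ y)) → st (map g v) ≡ st v
st-map g v h = trans (sym (map-∘ v)) (map-cong-local (All.tabulate (λ {y} _ → cong suc (go v y (λ x m → h x y m)))))
  where
  go : ∀ l y → (∀ x → x ∈ l → (g x <ᵇ g y) ≡ (x <ᵇ y)) →
    length (filterᵇ (_<ᵇ g y) (map g l)) ≡ length (filterᵇ (_<ᵇ y) l)
  go []      y e = refl
  go (x ∷ l) y e rewrite e x (here refl) with x <ᵇ y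
  ... | true  = cong suc (go l y (λ z m → e z (there m)))
  ... | false = go l y (λ z m → e z (there m))

length-filter-all : ∀ {A : Set} (p : A → Bool) l → All (λ x → p x ≡ true) l → length (filterᵇ p l) ≡ length l
length-filter-all p []      []      = refl
length-filter-all p (x ∷ l) (e ∷ h) rewrite e = cong suc (length-filter-all p l h)

rank-max : ∀ v m v' → All (ℕ._< m) v → All (ℕ._< m) v' → rank (v ++ m ∷ v') m ≡ length (v ++ m ∷ v')
rank-max [] m v' [] lt' rewrite <ᵇ-false {m} ℕP.≤-refl =
  cong suc (length-filter-all (_<ᵇ m) v' (All.map <ᵇ-true lt'))
rank-max (x ∷ v) m v' (p ∷ lt) lt' rewrite <ᵇ-true p = cong suc (rank-max v m v' lt lt')

splitAtVal-++ : ∀ n v v' → All (_≢ n) v → splitAtVal n (v ++ n ∷ v') ≡ (v , v')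
splitAtVal-++ n []      v' []       rewrite dec-true (n ℕ.≟ n) refl = refl
splitAtVal-++ n (x ∷ v) v' (p ∷ ps) rewrite dec-false (x ℕ.≟ n) p | splitAtVal-++ n v v' ps = refl

λF-++ : ∀ k v n v' → n ≡ length (v ++ n ∷ v') → All (_≢ n) v →
  λF (suc k) (v ++ n ∷ v') ≡ node (λF k (st v)) (λF k (st v'))
λF-++ k v n v' e ne = trans (unfold v)
  (cong (λ s → node (λF k (st (proj₁ s))) (λF k (st (proj₂ s))))
    (trans (cong (λ l → splitAtVal l (v ++ n ∷ v')) (sym e)) (splitAtVal-++ n v v' ne)))
  where
  -- The clause of `λF` expects a visible head, which the case split on `v` provides.
  unfold : ∀ v → let σ = v ++ n ∷ v' in λF (suc k) σ ≡
    node (λF k (st (proj₁ (splitAtVal (length σ) σ)))) (λF k (st (proj₂ (splitAtVal (length σ) σ))))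
  unfold []      = refl
  unfold (x ∷ v) = refl

λF-st-++ : ∀ k v m v' → All (ℕ._< m) v → All (ℕ._< m) v' →
  λF (suc k) (st (v ++ m ∷ v')) ≡ node (λF k (st v)) (λF k (st v'))
λF-st-++ k v m v' lt lt' = begin
  λF (suc k) (map g (v ++ m ∷ v'))       ≡⟨ cong (λF (suc k)) (map-++ g v (m ∷ v')) ⟩
  λF (suc k) (map g v ++ g m ∷ map g v') ≡⟨ λF-++ k (map g v) (g m) (map g v') len (AllP.map⁺ ne) ⟩
  node (λF k (st (map g v))) (λF k (st (map g v')))
    ≡⟨ cong₂ (λ a b → node (λF k a) (λF k b))
         (st-map g v (λ x y x∈ → rank-<ᵇ σ {y = y} (∈-++⁺ˡ x∈)))
         (st-map g v' (λ x y x∈ → rank-<ᵇ σ {y = y} (∈-++⁺ʳ v (there x∈)))) ⟩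
  node (λF k (st v)) (λF k (st v')) ∎
  where
  σ = v ++ m ∷ v'
  g = rank σ
  len : g m ≡ length (map g v ++ g m ∷ map g v')
  len = trans (rank-max v m v' lt lt') (trans (sym (length-map g σ)) (cong length (map-++ g v (m ∷ v'))))
  ne : All (λ x → g x ≢ g m) v
  ne = All.tabulate (λ x∈ → ℕP.<⇒≢ (rank-mono-< σ (∈-++⁺ˡ x∈) (All.lookup lt x∈)))

reverse-++-∷ : ∀ (w₂ : List ℕ) m w₁ → reverse (w₂ ++ m ∷ w₁) ≡ reverse w₁ ++ m ∷ reverse w₂
reverse-++-∷ w₂ m w₁ = trans (reverse-++ w₂ (m ∷ w₁))
  (trans (cong (_++ reverse w₂) (unfold-reverse m w₁)) (++-assoc (reverse w₁) [ m ] (reverse w₂)))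

All-reverse : ∀ {P : ℕ → Set} w → All P w → All P (reverse w)
All-reverse w = All-resp-↭ (↭-sym (↭-reverse w))

length-++-∷ : ∀ (w₂ : List ℕ) m w₁ → length (w₂ ++ m ∷ w₁) ≡ suc (length w₂ + length w₁)
length-++-∷ w₂ m w₁ = trans (length-++ w₂) (ℕP.+-suc (length w₂) (length w₁))

λF-Decr : ∀ k {w t} → Decr w t → length w ℕ.≤ k → λF k (st (reverse w)) ≡ t
λF-Decr zero    leaf h = refl
λF-Decr (suc k) leaf h = refl
λF-Decr k (node {w₁} {w₂} {m} lt₁ lt₂ d₁ d₂) h with k | subst (ℕ._≤ k) (length-++-∷ w₂ m w₁) h
... | suc k' | s≤s h' = begin
  _ ≡⟨ cong (λF (suc k') ∘ st) (reverse-++-∷ w₂ m w₁) ⟩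
  _ ≡⟨ λF-st-++ k' (reverse w₁) m (reverse w₂) (All-reverse w₁ lt₁) (All-reverse w₂ lt₂) ⟩
  _ ≡⟨ cong₂ node (λF-Decr k' d₁ (ℕP.≤-trans (ℕP.m≤n+m _ (length w₂)) h'))
         (λF-Decr k' d₂ (ℕP.≤-trans (ℕP.m≤m+n _ (length w₁)) h')) ⟩
  _ ∎

-- `λₚ` does not standardize its own argument, so its first step splits at the maximal letter only
-- if that letter equals the length. Deeper levels standardize the pieces.
Topped : List ℕ → Set
Topped w = All (ℕ._≤ length w) w × (w ≡ [] ⊎ length w ∈ w)

λₚ-Decr : ∀ {w t} → Decr w t → Topped w → λₚ (reverse w) ≡ t
λₚ-Decr leaf _ = refl
λₚ-Decr (node {w₁} {w₂} {m} {t₁} {t₂} lt₁ lt₂ d₁ d₂) (bound , top) = begin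
  λₚ (reverse w) ≡⟨ cong₂ λF (trans (length-reverse w) (length-++-∷ w₂ m w₁)) (reverse-++-∷ w₂ m w₁) ⟩
  λF (suc k) (reverse w₁ ++ m ∷ reverse w₂)
    ≡⟨ λF-++ k (reverse w₁) m (reverse w₂)
         (trans m≡len (trans (sym (length-reverse w)) (cong length (reverse-++-∷ w₂ m w₁))))
         (All.map ℕP.<⇒≢ (All-reverse w₁ lt₁)) ⟩
  _ ≡⟨ cong₂ node (λF-Decr k d₁ (ℕP.m≤n+m _ (length w₂))) (λF-Decr k d₂ (ℕP.m≤m+n _ (length w₁))) ⟩
  node t₁ t₂ ∎
  where
  w = w₂ ++ m ∷ w₁
  k = length w₂ + length w₁
  ≤m : All (ℕ._≤ m) w
  ≤m = AllP.++⁺ (All.map ℕP.<⇒≤ lt₂) (ℕP.≤-refl ∷ All.map ℕP.<⇒≤ lt₁)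
  len≤m : w ≡ [] ⊎ length w ∈ w → length w ℕ.≤ m
  len≤m (inj₁ e)  = subst (ℕ._≤ m) (cong length (sym e)) z≤n
  len≤m (inj₂ w∈) = All.lookup ≤m w∈
  m≡len : m ≡ length w
  m≡len = ℕP.≤-antisym (All.lookup bound (∈-++⁺ʳ w₂ (here refl))) (len≤m top)

Topped-↭ : ∀ {w w'} → w' ↭ w → Topped w → Topped w'
Topped-↭ {w} {w'} p (bound , top) =
  All.map (λ {x} → subst (x ℕ.≤_) (sym (↭-length p))) (All-resp-↭ (↭-sym p) bound) , move top
  where
  move : w ≡ [] ⊎ length w ∈ w → w' ≡ [] ⊎ length w' ∈ w'
  move (inj₂ w∈) = inj₂ (subst (_∈ w') (sym (↭-length p)) (∈-resp-↭ (↭-sym p) w∈))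
  move (inj₁ e)  = inj₁ (↭-empty-inv (subst (w' ↭_) e p))

Decr-map : ∀ c {w t} → Decr w t → Decr (map (_+ c) w) t
Decr-map c leaf = leaf
Decr-map c (node {w₁} {w₂} {m} lt₁ lt₂ d₁ d₂) =
  subst (λ w → Decr w _) (sym (map-++ (_+ c) w₂ (m ∷ w₁)))
    (node (AllP.map⁺ (All.map (ℕP.+-monoˡ-< c) lt₁)) (AllP.map⁺ (All.map (ℕP.+-monoˡ-< c) lt₂))
      (Decr-map c d₁) (Decr-map c d₂))

length-γ : ∀ t → length (γ t) ≡ size t
length-γ leaf       = refl
length-γ (node l r) = trans (length-++-∷ (map _ (γ l)) _ (γ r))
  (cong suc (cong₂ _+_ (trans (length-map _ (γ l)) (length-γ l)) (length-γ r)))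

γ-bounds : ∀ t → All (λ x → 0 ℕ.< x × x ℕ.≤ length (γ t)) (γ t)
γ-bounds leaf       = []
γ-bounds (node l r) = All.map (λ {x} (p , q) → p , subst (x ℕ.≤_) (sym len) q)
  (AllP.++⁺ (AllP.map⁺ (All.map (λ (p , q) → ℕP.≤-trans p (ℕP.m≤m+n _ _) ,
      ℕP.m≤n⇒m≤1+n (ℕP.+-monoˡ-≤ (length (γ r)) q)) (γ-bounds l)))
    ((subst (0 ℕ.<_) (ℕP.+-comm 1 _) (s≤s z≤n) , ℕP.≤-reflexive (ℕP.+-comm _ 1))
      ∷ All.map (λ (p , q) → p , ℕP.≤-trans q (ℕP.m≤n⇒m≤1+n (ℕP.m≤n+m _ (length (γ l))))) (γ-bounds r)))
  where
  len : length (γ (node l r)) ≡ suc (length (γ l) + length (γ r))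
  len = trans (length-++-∷ (map _ (γ l)) _ (γ r)) (cong (λ z → suc (z + length (γ r))) (length-map _ (γ l)))

γ-top : ∀ t → γ t ≡ [] ⊎ length (γ t) ∈ γ t
γ-top leaf       = inj₁ refl
γ-top (node l r) = inj₂ (∈-++⁺ʳ (map _ (γ l)) (here (trans (length-++-∷ (map _ (γ l)) _ (γ r))
  (trans (cong (λ z → suc (z + length (γ r))) (length-map _ (γ l))) (ℕP.+-comm 1 _)))))

Decr-γ : ∀ t → Decr (reverse (γ t)) t
Decr-γ leaf       = leaf
Decr-γ (node l r) = subst (λ w → Decr w (node l r)) (sym (reverse-++-∷ (map (_+ length (γ r)) (γ l)) _ (γ r)))
  (node (All-reverse (map _ (γ l)) (AllP.map⁺ (All.map (λ (_ , q) → below (ℕP.+-monoˡ-≤ (length (γ r)) q)) (γ-bounds l))))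
        (All-reverse (γ r) (All.map (λ (_ , q) → below (ℕP.≤-trans q (ℕP.m≤n+m _ (length (γ l))))) (γ-bounds r)))
        (subst (λ w → Decr w l) (reverse-map _ (γ l)) (Decr-map (length (γ r)) (Decr-γ l)))
        (Decr-γ r))
  where
  below : ∀ {x n} → x ℕ.≤ n → x ℕ.< n + 1
  below {x} {n} p = subst (x ℕ.<_) (ℕP.+-comm 1 n) (s≤s p)

Topped-/ₚ : ∀ a b → Topped (γ a /ₚ γ b)
Topped-/ₚ a b = AllP.++⁺
    (All.map (λ {x} (_ , q) → subst (x ℕ.≤_) (sym len) (ℕP.≤-trans q (ℕP.m≤m+n _ (length (γ b))))) (γ-bounds a))
    (AllP.map⁺ (All.map (λ {x} (_ , q) → subst (x + length (γ a) ℕ.≤_) (sym len')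
      (ℕP.+-monoˡ-≤ (length (γ a)) q)) (γ-bounds b)))
  , top (γ-top a) (γ-top b)
  where
  len : length (γ a /ₚ γ b) ≡ length (γ a) + length (γ b)
  len = trans (length-++ (γ a)) (cong (_+_ (length (γ a))) (length-map _ (γ b)))
  len' : length (γ a /ₚ γ b) ≡ length (γ b) + length (γ a)
  len' = trans len (ℕP.+-comm (length (γ a)) _)
  HasTop : List ℕ → Set
  HasTop w = w ≡ [] ⊎ length w ∈ w
  top : HasTop (γ a) → HasTop (γ b) → HasTop (γ a /ₚ γ b)
  top _  (inj₂ b∈) = inj₂ (∈-++⁺ʳ (γ a) (subst (_∈ map (_+ length (γ a)) (γ b)) (sym len') (∈-map⁺ (_+ length (γ a)) b∈)))
  top ta (inj₁ e)  = subst (λ τ → HasTop (γ a /ₚ τ)) (sym e) (subst HasTop (sym (++-identityʳ (γ a))) ta)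

-- Shuffle permutations

insertAll-↭ : ∀ x ζ {ξ} → ξ ∈ insertAll x ζ → ξ ↭ x ∷ ζ
insertAll-↭ x []      (here refl) = ↭-refl
insertAll-↭ x (y ∷ ζ) (here refl) = ↭-refl
insertAll-↭ x (y ∷ ζ) (there m) with ∈-map⁻ (y ∷_) m
... | ξ , ξ∈ , refl = ↭-trans (prep y (insertAll-↭ x ζ ξ∈)) (swap y x ↭-refl)

perms-∈ : ∀ n {ζ} → ζ ∈ perms n → length ζ ≡ n × All (λ x → 0 ℕ.< x × x ℕ.≤ n) ζ
perms-∈ zero    (here refl) = refl , []
perms-∈ (suc n) ζ∈ with find (∈-concatMap⁻ (insertAll (suc n)) {xs = perms n} ζ∈)
... | ζ' , ζ'∈ , m with perms-∈ n ζ'∈ | insertAll-↭ (suc n) ζ' m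
... | len , bounds | p = trans (↭-length p) (cong suc len) ,
  All-resp-↭ (↭-sym p) ((s≤s z≤n , ℕP.≤-refl) ∷ All.map (λ (a , b) → a , ℕP.m≤n⇒m≤1+n b) bounds)

at-zero : ∀ L → at L 0 ≡ 0
at-zero []      = refl
at-zero (x ∷ L) = refl

-- An absent letter has position 0, where every list reads 0; both sides are 0 in that case.
at-posOf-∷ : ∀ i l L z ζ →
  at (l ∷ L) (posOf i (z ∷ ζ)) ≡ (if z ≡ᵇ i then l else at L (posOf i ζ))
at-posOf-∷ i l L z ζ with z ≡ᵇ i
... | true = refl
... | false with posOf i ζ
...   | zero  = sym (at-zero L)
...   | suc j = refl

at-posOf-≢ : ∀ i N x (A B α β : List ℕ) → length A ≡ length α → N ≢ i →
  at (A ++ x ∷ B) (posOf i (α ++ N ∷ β)) ≡ at (A ++ B) (posOf i (α ++ β))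
at-posOf-≢ i N x [] B [] β e ne = trans (at-posOf-∷ i x B N β)
  (cong (λ b → if b then x else at B (posOf i β)) (dec-false (N ℕ.≟ i) ne))
at-posOf-≢ i N x (a ∷ A) B (y ∷ α) β e ne = begin
  _ ≡⟨ at-posOf-∷ i a (A ++ x ∷ B) y (α ++ N ∷ β) ⟩
  _ ≡⟨ cong (if y ≡ᵇ i then a else_) (at-posOf-≢ i N x A B α β (ℕP.suc-injective e) ne) ⟩
  _ ≡⟨ at-posOf-∷ i a (A ++ B) y (α ++ β) ⟨
  _ ∎

at-posOf-≡ : ∀ N x (A B α β : List ℕ) → length A ≡ length α → All (ℕ._< N) α →
  at (A ++ x ∷ B) (posOf N (α ++ N ∷ β)) ≡ x
at-posOf-≡ N x [] B [] β e [] = trans (at-posOf-∷ N x B N β)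
  (cong (λ b → if b then x else at B (posOf N β)) (dec-true (N ℕ.≟ N) refl))
at-posOf-≡ N x (a ∷ A) B (y ∷ α) β e (p ∷ lt) = trans (at-posOf-∷ N a (A ++ x ∷ B) y (α ++ N ∷ β))
  (trans (cong (λ b → if b then a else at (A ++ x ∷ B) (posOf N (α ++ N ∷ β))) (dec-false (y ℕ.≟ N) (ℕP.<⇒≢ p)))
    (at-posOf-≡ N x A B α β (ℕP.suc-injective e) lt))

-- `L ·ₚ inv ζ` lists, for i = 1, 2, ..., the letter of `L` standing where `ζ` has i. A new maximal
-- value in `ζ` thus adds one last letter: the one inserted at the same place in `L`.
·ₚ-inv-insert : ∀ n x (A B α β : List ℕ) → length A ≡ length α → length (α ++ β) ≡ n → All (ℕ._< suc n) α →
  (A ++ x ∷ B) ·ₚ inv (α ++ suc n ∷ β) ≡ ((A ++ B) ·ₚ inv (α ++ β)) ∷ʳ x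
·ₚ-inv-insert n x A B α β eA eζ lt = begin
  map (at (A ++ x ∷ B)) (map (pos (α ++ suc n ∷ β)) (upTo (length (α ++ suc n ∷ β))))
    ≡⟨ map-∘ _ ⟨
  map (g (A ++ x ∷ B) (α ++ suc n ∷ β)) (upTo (length (α ++ suc n ∷ β)))
    ≡⟨ cong (map _) (trans (cong upTo len) (sym (upTo-∷ʳ n))) ⟩
  map (g (A ++ x ∷ B) (α ++ suc n ∷ β)) (upTo n ∷ʳ n)
    ≡⟨ map-++ _ (upTo n) (n ∷ []) ⟩
  map (g (A ++ x ∷ B) (α ++ suc n ∷ β)) (upTo n) ∷ʳ g (A ++ x ∷ B) (α ++ suc n ∷ β) n
    ≡⟨ cong₂ _∷ʳ_ (map-cong-local (All.tabulate (λ {i} i∈ → at-posOf-≢ (suc i) (suc n) x A B α β eA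
         (λ e → ℕP.<⇒≢ (∈-upTo⁻ i∈) (sym (ℕP.suc-injective e))))))
         (at-posOf-≡ (suc n) x A B α β eA lt) ⟩
  map (g (A ++ B) (α ++ β)) (upTo n) ∷ʳ x
    ≡⟨ cong (_∷ʳ x) (trans (cong (map (g (A ++ B) (α ++ β)) ∘ upTo) (sym eζ)) (map-∘ _)) ⟩
  ((A ++ B) ·ₚ inv (α ++ β)) ∷ʳ x ∎
  where
  pos : List ℕ → ℕ → ℕ
  pos ζ i = posOf (suc i) ζ
  g : List ℕ → List ℕ → ℕ → ℕ
  g L ζ i = at L (posOf (suc i) ζ)
  len : length (α ++ suc n ∷ β) ≡ suc n
  len = trans (length-++-∷ α (suc n) β) (cong suc (trans (sym (length-++ α)) eζ))

·ₚ-inv-∷ʳ : ∀ n y L ζ → length L ≡ length ζ → length ζ ≡ n → All (ℕ._< suc n) ζ →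
  (L ∷ʳ y) ·ₚ inv (ζ ∷ʳ suc n) ≡ (L ·ₚ inv ζ) ∷ʳ y
·ₚ-inv-∷ʳ n y L ζ eL eζ lt = trans
  (·ₚ-inv-insert n y L [] ζ [] eL (trans (cong length (++-identityʳ ζ)) eζ) lt)
  (cong₂ (λ A α → (A ·ₚ inv α) ∷ʳ y) (++-identityʳ L) (++-identityʳ ζ))

-- Recording the previous letter m makes the shuffle condition on ζ recursive.
runs : ℕ → ℕ → List ℕ → Bool
runs m zero    ζ       = increasing ζ
runs m (suc p) []      = true
runs m (suc p) (x ∷ ζ) = (m <ᵇ x) ∧ runs x p ζ

runs-take-drop : ∀ m p ζ → increasing (m ∷ take p ζ) ∧ increasing (drop p ζ) ≡ runs m p ζ
runs-take-drop m zero    ζ       = refl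
runs-take-drop m (suc p) []      = refl
runs-take-drop m (suc p) (x ∷ ζ) = trans (∧-assoc (m <ᵇ x) (increasing (x ∷ take p ζ)) (increasing (drop p ζ)))
  (cong ((m <ᵇ x) ∧_) (runs-take-drop x p ζ))

shuffle-runs : ∀ p ζ → All (0 ℕ.<_) ζ → increasing (take p ζ) ∧ increasing (drop p ζ) ≡ runs 0 p ζ
shuffle-runs p ζ pos = trans (cong (_∧ increasing (drop p ζ)) (from0 p ζ pos)) (runs-take-drop 0 p ζ)
  where
  from0 : ∀ p ζ → All (0 ℕ.<_) ζ → increasing (take p ζ) ≡ increasing (0 ∷ take p ζ)
  from0 zero    ζ       _       = refl
  from0 (suc p) []      _       = refl
  from0 (suc p) (x ∷ ζ) (0<x ∷ _) = cong (_∧ increasing (x ∷ take p ζ)) (sym (<ᵇ-true 0<x))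

⟦∧⟧-* : ∀ b c x → ⟦ b ∧ c ⟧ * x ≡ ⟦ b ⟧ * (⟦ c ⟧ * x)
⟦∧⟧-* b c x = trans (cong (_* x) (⟦∧⟧ b c)) (ℤP.*-assoc ⟦ b ⟧ ⟦ c ⟧ x)

-- Anywhere but at the end, the maximum would be followed by a smaller letter.
∑-insertAll-increasing-∷ : ∀ N m ζ → All (ℕ._< N) ζ → m ℕ.< N → (F : List ℕ → ℤ) →
  ∑ (insertAll N ζ) (λ ξ → ⟦ increasing (m ∷ ξ) ⟧ * F ξ) ≡ ⟦ increasing (m ∷ ζ) ⟧ * F (ζ ∷ʳ N)
∑-insertAll-increasing-∷ N m [] [] m<N F rewrite <ᵇ-true m<N = ℤP.+-identityʳ _
∑-insertAll-increasing-∷ N m (y ∷ ζ) (y<N ∷ lt) m<N F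
  rewrite <ᵇ-true m<N | <ᵇ-false {N} {y} (ℕP.<⇒≤ y<N) = begin
  _ ≡⟨ ℤP.+-identityˡ _ ⟩
  _ ≡⟨ ∑-map (insertAll N ζ) (y ∷_) _ ⟩
  _ ≡⟨ ∑-cong (insertAll N ζ) (λ ξ → ⟦∧⟧-* (m <ᵇ y) (increasing (y ∷ ξ)) (F (y ∷ ξ))) ⟩
  _ ≡⟨ ∑-*ˡ (insertAll N ζ) ⟦ m <ᵇ y ⟧ _ ⟨
  _ ≡⟨ cong (⟦ m <ᵇ y ⟧ *_) (∑-insertAll-increasing-∷ N y ζ lt y<N (F ∘ (y ∷_))) ⟩
  _ ≡⟨ ⟦∧⟧-* (m <ᵇ y) (increasing (y ∷ ζ)) _ ⟨
  _ ∎

∑-insertAll-increasing : ∀ N ζ → All (ℕ._< N) ζ → (F : List ℕ → ℤ) →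
  ∑ (insertAll N ζ) (λ ξ → ⟦ increasing ξ ⟧ * F ξ) ≡ ⟦ increasing ζ ⟧ * F (ζ ∷ʳ N)
∑-insertAll-increasing N []      []         F = ℤP.+-identityʳ _
∑-insertAll-increasing N (y ∷ ζ) (y<N ∷ lt) F rewrite <ᵇ-false {N} {y} (ℕP.<⇒≤ y<N) = begin
  _ ≡⟨ ℤP.+-identityˡ _ ⟩
  _ ≡⟨ ∑-map (insertAll N ζ) (y ∷_) _ ⟩
  _ ≡⟨ ∑-insertAll-increasing-∷ N y ζ lt y<N (F ∘ (y ∷_)) ⟩
  _ ∎

-- The maximum can only be inserted at the end of one of the two runs.
∑-insertAll-runs : ∀ N m p ζ → All (ℕ._< N) ζ → m ℕ.< N → p ℕ.≤ length ζ → (F : List ℕ → ℤ) →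
  ∑ (insertAll N ζ) (λ ξ → ⟦ runs m (suc p) ξ ⟧ * F ξ) ≡
  ⟦ runs m p ζ ⟧ * F (take p ζ ++ N ∷ drop p ζ)
  +ℤ ⟦ p <ᵇ length ζ ⟧ * (⟦ runs m (suc p) ζ ⟧ * F (ζ ∷ʳ N))
-- With an empty second run both runs end at the same place; the guard `p <ᵇ length ζ` keeps it from
-- being counted twice.
∑-insertAll-runs N m zero [] [] m<N h F rewrite <ᵇ-true m<N = refl
∑-insertAll-runs N m zero (y ∷ ζ) (y<N ∷ lt) m<N h F rewrite <ᵇ-true m<N =
  cong (_+ℤ_ (⟦ increasing (y ∷ ζ) ⟧ * F (N ∷ y ∷ ζ))) (begin
  _ ≡⟨ ∑-map (insertAll N ζ) (y ∷_) _ ⟩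
  _ ≡⟨ ∑-cong (insertAll N ζ) (λ ξ → ⟦∧⟧-* (m <ᵇ y) (increasing ξ) (F (y ∷ ξ))) ⟩
  _ ≡⟨ ∑-*ˡ (insertAll N ζ) ⟦ m <ᵇ y ⟧ _ ⟨
  _ ≡⟨ cong (⟦ m <ᵇ y ⟧ *_) (∑-insertAll-increasing N ζ lt (F ∘ (y ∷_))) ⟩
  _ ≡⟨ ⟦∧⟧-* (m <ᵇ y) (increasing ζ) _ ⟨
  _ ≡⟨ ℤP.*-identityˡ _ ⟨
  _ ∎)
∑-insertAll-runs N m (suc p) (y ∷ ζ) (y<N ∷ lt) m<N (s≤s h) F
  rewrite <ᵇ-true m<N | <ᵇ-false {N} {y} (ℕP.<⇒≤ y<N) = begin
  _ ≡⟨ ℤP.+-identityˡ _ ⟩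
  _ ≡⟨ ∑-map (insertAll N ζ) (y ∷_) _ ⟩
  _ ≡⟨ ∑-cong (insertAll N ζ) (λ ξ → ⟦∧⟧-* (m <ᵇ y) (runs y (suc p) ξ) (F (y ∷ ξ))) ⟩
  _ ≡⟨ ∑-*ˡ (insertAll N ζ) ⟦ m <ᵇ y ⟧ _ ⟨
  _ ≡⟨ cong (⟦ m <ᵇ y ⟧ *_) (∑-insertAll-runs N y p ζ lt y<N h (F ∘ (y ∷_))) ⟩
  _ ≡⟨ distribute ⟦ m <ᵇ y ⟧ (⟦ runs y p ζ ⟧ * F (y ∷ take p ζ ++ N ∷ drop p ζ)) ⟦ p <ᵇ length ζ ⟧
         (⟦ runs y (suc p) ζ ⟧ * F (y ∷ ζ ∷ʳ N)) ⟩
  _ ≡⟨ cong₂ (λ a b → a +ℤ ⟦ p <ᵇ length ζ ⟧ * b)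
         (sym (⟦∧⟧-* (m <ᵇ y) (runs y p ζ) (F (y ∷ take p ζ ++ N ∷ drop p ζ))))
         (sym (⟦∧⟧-* (m <ᵇ y) (runs y (suc p) ζ) (F (y ∷ ζ ∷ʳ N)))) ⟩
  _ ∎
  where
  distribute : ∀ a b c d → a * (b +ℤ c * d) ≡ a * b +ℤ c * (a * d)
  distribute = solve-∀

-- Shared by the two cases with a nonempty first word. Inserting `suc n` at the end of the first run
-- makes `x` the last letter; `rest` is the contribution of the end of the second run, which
-- vanishes if the second word is empty and otherwise leads to a recursive call.
module PermsStep (n : ℕ) (x : ℕ) (xs ys : List ℕ) (e : n ≡ length xs + length ys) (f : List ℕ → ℤ) where

  p = length xs

  labelled : List ℕ → List ℕ
  labelled ζ = (reverse (x ∷ xs) ++ reverse ys) ·ₚ inv ζ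

  rest : List ℕ → ℤ
  rest ζ = ⟦ p <ᵇ length ζ ⟧ * (⟦ runs 0 (suc p) ζ ⟧ * f (labelled (ζ ∷ʳ suc n)))

  labelled-insert : ∀ ζ → length ζ ≡ n → All (ℕ._< suc n) ζ →
    labelled (take p ζ ++ suc n ∷ drop p ζ) ≡ ((reverse xs ++ reverse ys) ·ₚ inv ζ) ∷ʳ x
  labelled-insert ζ len lt = begin
    _ ≡⟨ cong (_·ₚ inv (take p ζ ++ suc n ∷ drop p ζ))
           (trans (cong (_++ reverse ys) (unfold-reverse x xs)) (++-assoc (reverse xs) [ x ] (reverse ys))) ⟩
    _ ≡⟨ ·ₚ-inv-insert n x (reverse xs) (reverse ys) (take p ζ) (drop p ζ) lenA
           (trans (cong length (take++drop≡id p ζ)) len)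
           (AllP.++⁻ˡ (take p ζ) (subst (All _) (sym (take++drop≡id p ζ)) lt)) ⟩
    _ ≡⟨ cong (λ z → ((reverse xs ++ reverse ys) ·ₚ inv z) ∷ʳ x) (take++drop≡id p ζ) ⟩
    _ ∎
    where
    lenA : length (reverse xs) ≡ length (take p ζ)
    lenA = trans (length-reverse xs) (sym (trans (length-take p ζ)
      (ℕP.m≤n⇒m⊓n≡m (subst (p ℕ.≤_) (sym (trans len e)) (ℕP.m≤m+n p (length ys))))))

  split : ∑ (perms (suc n)) (λ ζ → ⟦ runs 0 (suc p) ζ ⟧ * f (labelled ζ)) ≡
    ∑ (perms n) (λ ζ → ⟦ runs 0 p ζ ⟧ * f (((reverse xs ++ reverse ys) ·ₚ inv ζ) ∷ʳ x)) +ℤ ∑ (perms n) rest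
  split = begin
    _ ≡⟨ ∑-concatMap (perms n) (insertAll (suc n)) _ ⟩
    _ ≡⟨ ∑-cong-∈ (perms n) (λ ζ ζ∈ → step ζ (perms-∈ n ζ∈)) ⟩
    _ ≡⟨ ∑-+ (perms n) _ rest ⟩
    _ ∎
    where
    step : ∀ ζ → length ζ ≡ n × All (λ x → 0 ℕ.< x × x ℕ.≤ n) ζ →
      ∑ (insertAll (suc n) ζ) (λ ξ → ⟦ runs 0 (suc p) ξ ⟧ * f (labelled ξ))
      ≡ ⟦ runs 0 p ζ ⟧ * f (((reverse xs ++ reverse ys) ·ₚ inv ζ) ∷ʳ x) +ℤ rest ζ
    step ζ (len , bounds) = trans
      (∑-insertAll-runs (suc n) 0 p ζ lt (s≤s z≤n)
        (subst (p ℕ.≤_) (sym (trans len e)) (ℕP.m≤m+n p (length ys))) (f ∘ labelled))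
      (cong (λ w → ⟦ runs 0 p ζ ⟧ * f w +ℤ rest ζ) (labelled-insert ζ len lt))
      where
      lt : All (ℕ._< suc n) ζ
      lt = All.map (λ (_ , q) → s≤s q) bounds

-- The value `n` ends one of the two runs of ζ, so the last letter of the product word is the last
-- letter of one factor, that is, the head of `xs` or of `ys`.
∑-perms-wordShuffles : ∀ n xs ys → n ≡ length xs + length ys → (f : List ℕ → ℤ) →
  ∑ (perms n) (λ ζ → ⟦ runs 0 (length xs) ζ ⟧ * f ((reverse xs ++ reverse ys) ·ₚ inv ζ))
  ≡ ∑ (wordShuffles xs ys) (f ∘ reverse)
∑-perms-wordShuffles zero [] [] e f = cong (_+ℤ + 0) (ℤP.*-identityˡ (f []))
∑-perms-wordShuffles (suc n) [] (y ∷ ys) e f = begin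
  _ ≡⟨ ∑-concatMap (perms n) (insertAll (suc n)) _ ⟩
  _ ≡⟨ ∑-cong-∈ (perms n) (λ ζ ζ∈ → step ζ (perms-∈ n ζ∈)) ⟩
  _ ≡⟨ ∑-perms-wordShuffles n [] ys (ℕP.suc-injective e) (λ w → f (w ∷ʳ y)) ⟩
  _ ≡⟨ cong (λ w → f w +ℤ + 0) (unfold-reverse y ys) ⟨
  _ ∎
  where
  step : ∀ ζ → length ζ ≡ n × All (λ x → 0 ℕ.< x × x ℕ.≤ n) ζ →
    ∑ (insertAll (suc n) ζ) (λ ξ → ⟦ increasing ξ ⟧ * f (reverse (y ∷ ys) ·ₚ inv ξ))
    ≡ ⟦ increasing ζ ⟧ * f ((reverse ys ·ₚ inv ζ) ∷ʳ y)
  step ζ (len , bounds) = trans (∑-insertAll-increasing (suc n) ζ lt _)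
    (cong (λ w → ⟦ increasing ζ ⟧ * f w) (trans (cong (_·ₚ inv (ζ ∷ʳ suc n)) (unfold-reverse y ys))
      (·ₚ-inv-∷ʳ n y (reverse ys) ζ (trans (length-reverse ys) (trans (sym (ℕP.suc-injective e)) (sym len))) len lt)))
    where
    lt : All (ℕ._< suc n) ζ
    lt = All.map (λ (_ , q) → s≤s q) bounds
∑-perms-wordShuffles (suc n) (x ∷ xs) [] e f = begin
  _ ≡⟨ split ⟩
  _ ≡⟨ cong₂ _+ℤ_ (∑-perms-wordShuffles n xs [] e' (λ w → f (w ∷ʳ x)))
         (∑-zero (perms n) (λ ζ ζ∈ → cong (λ b → ⟦ b ⟧ * (⟦ runs 0 (suc p) ζ ⟧ * f (labelled (ζ ∷ʳ suc n))))
           (<ᵇ-false (ℕP.≤-reflexive (trans (proj₁ (perms-∈ n ζ∈)) (trans e' (ℕP.+-identityʳ p))))))) ⟩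
  _ ≡⟨ cong (_+ℤ + 0) (∑-wordShuffles-[] xs _) ⟩
  _ ≡⟨ cong (λ w → f w +ℤ + 0) (unfold-reverse x xs) ⟨
  _ ∎
  where
  e' = ℕP.suc-injective e
  open PermsStep n x xs [] e' f
∑-perms-wordShuffles (suc n) (x ∷ xs) (y ∷ ys) e f = begin
  _ ≡⟨ split ⟩
  _ ≡⟨ cong₂ _+ℤ_ (∑-perms-wordShuffles n xs (y ∷ ys) e' (λ w → f (w ∷ʳ x)))
         (trans (∑-cong-∈ (perms n) (λ ζ ζ∈ → step ζ (perms-∈ n ζ∈)))
           (∑-perms-wordShuffles n (x ∷ xs) ys e'' (λ w → f (w ∷ʳ y)))) ⟩
  _ ≡⟨ cong₂ _+ℤ_ (∑-cong (wordShuffles xs (y ∷ ys)) (λ z → cong f (sym (unfold-reverse x z))))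
         (∑-cong (wordShuffles (x ∷ xs) ys) (λ z → cong f (sym (unfold-reverse y z)))) ⟩
  _ ≡⟨ ∑-wordShuffles-∷ x xs y ys (f ∘ reverse) ⟨
  _ ∎
  where
  e' = ℕP.suc-injective e
  e'' = trans e' (ℕP.+-suc (length xs) (length ys))
  open PermsStep n x xs (y ∷ ys) e' f
  L = reverse (x ∷ xs) ++ reverse ys
  L∷ʳy : reverse (x ∷ xs) ++ reverse (y ∷ ys) ≡ L ∷ʳ y
  L∷ʳy = trans (cong (reverse (x ∷ xs) ++_) (unfold-reverse y ys))
    (sym (++-assoc (reverse (x ∷ xs)) (reverse ys) [ y ]))
  step : ∀ ζ → length ζ ≡ n × All (λ x → 0 ℕ.< x × x ℕ.≤ n) ζ →
    rest ζ ≡ ⟦ runs 0 (suc p) ζ ⟧ * f ((L ·ₚ inv ζ) ∷ʳ y)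
  step ζ (len , bounds) = trans
    (cong₂ (λ b w → ⟦ b ⟧ * (⟦ runs 0 (suc p) ζ ⟧ * f w))
      (<ᵇ-true (subst (p ℕ.<_) (sym (trans len e'')) (s≤s (ℕP.m≤m+n p (length ys)))))
      (trans (cong (_·ₚ inv (ζ ∷ʳ suc n)) L∷ʳy)
        (·ₚ-inv-∷ʳ n y L ζ lenL len (All.map (λ (_ , q) → s≤s q) bounds))))
    (ℤP.*-identityˡ _)
    where
    lenL : length L ≡ length ζ
    lenL = trans (length-++ (reverse (x ∷ xs))) (trans
      (cong₂ _+_ (length-reverse (x ∷ xs)) (length-reverse ys)) (sym (trans len e'')))

∑-Sh : ∀ p q (F : List ℕ → ℤ) → ∑ (Sh p q) F ≡ ∑ (perms (p + q)) (λ ζ → ⟦ runs 0 p ζ ⟧ * F ζ)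
∑-Sh p q F = trans (∑-filter _ (perms (p + q)) F) (∑-cong-∈ (perms (p + q)) (λ ζ ζ∈ →
  cong (λ b → ⟦ b ⟧ * F ζ) (shuffle-runs p ζ (All.map proj₁ (proj₂ (perms-∈ (p + q) ζ∈))))))

∑-prodF : ∀ a b (f : Tree → ℤ) → ∑ (prodF a b) (λ (c , x) → c * f x) ≡ ∑ (shuffles a b) f
∑-prodF a b f = begin
  _ ≡⟨ ∑-map (Sh (size a) (size b)) _ _ ⟩
  _ ≡⟨ ∑-cong (Sh (size a) (size b)) (λ ζ → ℤP.*-identityˡ (F ((γ a /ₚ γ b) ·ₚ inv ζ))) ⟩
  _ ≡⟨ ∑-Sh (size a) (size b) _ ⟩
  _ ≡⟨ ∑-cong (perms (size a + size b)) (λ ζ → cong₂ (λ p L → ⟦ runs 0 p ζ ⟧ * F (L ·ₚ inv ζ))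
         (sym lenX) (sym words)) ⟩
  _ ≡⟨ ∑-perms-wordShuffles (size a + size b) xs ys (sym (cong₂ _+_ lenX lenY)) F ⟩
  -- Each term permutes the letters of `γ a /ₚ γ b`, hence is `Topped`, and `λₚ` recovers its
  -- decreasing tree.
  _ ≡⟨ ∑-wordShuffles-shuffles (Decr-γ a) decrY separated (F ∘ reverse) f (λ z perm dz →
         cong f (λₚ-Decr dz (Topped-↭ (↭-trans perm (++⁺ (↭-reverse (γ a)) (↭-reverse τ))) (Topped-/ₚ a b)))) ⟩
  _ ∎
  where
  F : List ℕ → ℤ
  F w = f (λₚ w)
  τ  = map (_+ length (γ a)) (γ b)
  xs = reverse (γ a)
  ys = reverse τ
  lenX : length xs ≡ size a
  lenX = trans (length-reverse (γ a)) (length-γ a)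
  lenY : length ys ≡ size b
  lenY = trans (length-reverse τ) (trans (length-map _ (γ b)) (length-γ b))
  words : reverse xs ++ reverse ys ≡ γ a /ₚ γ b
  words = cong₂ _++_ (reverse-involutive (γ a)) (reverse-involutive τ)
  decrY : Decr ys b
  decrY = subst (λ w → Decr w b) (reverse-map _ (γ b)) (Decr-map (length (γ a)) (Decr-γ b))
  separated : All (λ y → All (ℕ._< y) xs) ys
  separated = All-reverse τ (AllP.map⁺ (All.map (λ (0<y , _) →
    All-reverse (γ a) (All.map (λ (_ , x≤) → ℕP.≤-<-trans x≤ (ℕP.m<n+m _ 0<y)) (γ-bounds a))) (γ-bounds b)))

-- The Tamari order

data Spine : Tree → Tree → Tree → Set where
  here  : ∀ {c d} → Spine c d (node c d)
  there : ∀ {P e c d} → Spine P e d → Spine (node c P) e (node c d)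

-- Relational counterpart of `le`, as `Spine` is of `spines`; it is shown below to coincide with the
-- order generated by rotations.
data _⊑_ : Tree → Tree → Set where
  leaf : leaf ⊑ leaf
  node : ∀ {x y P d t} → Spine P d t → x ⊑ P → y ⊑ d → node x y ⊑ t

⊑-refl : ∀ t → t ⊑ t
⊑-refl leaf       = leaf
⊑-refl (node l r) = node here (⊑-refl l) (⊑-refl r)

-- Of two successive cuts along the spine, the lower one can be made first; a rotation at the root
-- amounts to this exchange.
Spine-assoc : ∀ {P d t P' d'} → Spine P d t → Spine P' d' d →
  ∃ λ Q → Spine Q d' t × Spine P P' Q
Spine-assoc here      s' = _ , there s' , here
Spine-assoc (there s) s' with Spine-assoc s s'
... | Q , q , r = _ , there q , there r

⟶-⊑ : ∀ {s s' t} → s ⟶ s' → s' ⊑ t → s ⊑ t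
⟶-⊑ (rot A B C)  (node s a (node s' b c)) with Spine-assoc s s'
... | Q , q , r = node q (node r a b) c
⟶-⊑ (congˡ t st) (node s x y) = node s (⟶-⊑ st x) y
⟶-⊑ (congʳ l st) (node s x y) = node s x (⟶-⊑ st y)

≤T⇒⊑ : ∀ {s t} → s ≤T t → s ⊑ t
≤T⇒⊑ ε        = ⊑-refl _
≤T⇒⊑ (st ◅ p) = ⟶-⊑ st (≤T⇒⊑ p)

-- One rotation per spine node above the cut brings that node back to the root.
Spine⇒≤T : ∀ {P d t} → Spine P d t → node P d ≤T t
Spine⇒≤T here      = ε
Spine⇒≤T (there s) = rot _ _ _ ◅ gmap (node _) (congʳ _) (Spine⇒≤T s)

⊑⇒≤T : ∀ {s t} → s ⊑ t → s ≤T t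
⊑⇒≤T leaf         = ε
⊑⇒≤T (node s x y) =
  gmap (λ z → node z _) (congˡ _) (⊑⇒≤T x) ◅◅ gmap (node _) (congʳ _) (⊑⇒≤T y) ◅◅ Spine⇒≤T s

≤T-size : ∀ {s t} → s ≤T t → size s ≡ size t
≤T-size ε        = refl
≤T-size (st ◅ p) = trans (sym (size-step st)) (≤T-size p)

Reflects : Set → ℤ → Set
Reflects R z = (R × z ≡ + 1) ⊎ (¬ R × z ≡ + 0)

-- At most one spine decomposition has a left part of the prescribed size.
∑-spines-reflects : ∀ (R : Tree → Tree → Set) (f : Tree × Tree → ℤ) k n →
  (∀ P d → Reflects (R P d) (f (P , d))) → (∀ P d → R P d → size P + k ≡ n) →
  ∀ t → Reflects (∃₂ λ P d → Spine P d t × R P d) (∑ (spines t) f)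
∑-spines-reflects R f k n dec sz leaf = inj₂ ((λ { (_ , _ , () , _) }) , refl)
∑-spines-reflects R f k n dec sz (node c d)
  rewrite ∑-map (spines d) (map₁ (node c)) f
  -- Left parts found in `d` lack the root and `c`; the offset `k` grows by their size, so the total
  -- `n` stays the same.
  with dec c d | ∑-spines-reflects (λ P e → R (node c P) e) (f ∘ map₁ (node c)) (suc (size c) + k) n
                   (λ P e → dec (node c P) e) (λ P e r → trans (lemma (size P) (size c) k) (sz _ _ r)) d
  where
  lemma : ∀ p c k → p + (suc c + k) ≡ suc (c + p) + k
  lemma = ℕSolver.solve-∀
... | inj₁ (r , e) | inj₁ ((P , _ , _ , r') , _) = ⊥-elim (clash (size c) (size P) k (trans (sz _ _ r) (sym (sz _ _ r'))))
  where
  clash : ∀ c p k → c + k ≢ suc (c + p) + k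
  clash c p k eq = ℕP.<-irrefl (ℕP.+-cancelʳ-≡ k c _ eq) (s≤s (ℕP.m≤m+n c p))
... | inj₁ (r , e) | inj₂ (_ , e') = inj₁ ((_ , _ , here , r) , cong₂ _+ℤ_ e e')
... | inj₂ (_ , e) | inj₁ ((P , _ , s , r) , e') = inj₁ ((_ , _ , there s , r) , cong₂ _+ℤ_ e e')
... | inj₂ (n' , e) | inj₂ (n'' , e') =
  inj₂ ((λ { (_ , _ , here , r) → n' r ; (_ , _ , there s , r) → n'' (_ , _ , s , r) }) , cong₂ _+ℤ_ e e')

le-reflects : ∀ s t → Reflects (s ⊑ t) (le s t)
le-reflects leaf leaf       = inj₁ (leaf , refl)
le-reflects leaf (node _ _) = inj₂ ((λ ()) , refl)
le-reflects (node x y) t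
  with ∑-spines-reflects (λ P d → x ⊑ P × y ⊑ d) (λ (P , d) → le x P * le y d) 0 (size x) both
         (λ P d (p , _) → trans (ℕP.+-identityʳ _) (sym (≤T-size (⊑⇒≤T p)))) t
  where
  both : ∀ P d → Reflects (x ⊑ P × y ⊑ d) (le x P * le y d)
  both P d with le-reflects x P | le-reflects y d
  ... | inj₁ (a , e) | inj₁ (b , e') = inj₁ ((a , b) , cong₂ _*_ e e')
  ... | inj₁ (a , e) | inj₂ (b , e') = inj₂ ((b ∘ proj₂) , trans (cong (le x P *_) e') (ℤP.*-zeroʳ (le x P)))
  ... | inj₂ (a , e) | _             = inj₂ ((a ∘ proj₁) , cong (_* le y d) e)
... | inj₁ ((P , d , s , a , b) , e) = inj₁ (node s a b , e)
... | inj₂ (n , e) = inj₂ ((λ { (node s a b) → n (_ , _ , s , a , b) }) , e)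

le-≤T? : ∀ s t → le s t ≡ ⟦ leqᵇ s t ⟧
le-≤T? s t with le-reflects s t
... | inj₁ (p , e) = trans e (cong ⟦_⟧ (sym (dec-true (s ≤T? t) (⊑⇒≤T p))))
... | inj₂ (n , e) = trans e (cong ⟦_⟧ (sym (dec-false (s ≤T? t) (n ∘ ≤T⇒⊑))))

le-yes : ∀ {s t} → s ≤T t → le s t ≡ + 1
le-yes {s} {t} p = trans (le-≤T? s t) (cong ⟦_⟧ (dec-true (s ≤T? t) p))

le-no : ∀ {s t} → ¬ s ≤T t → le s t ≡ + 0
le-no {s} {t} p = trans (le-≤T? s t) (cong ⟦_⟧ (dec-false (s ≤T? t) p))

<T⇒wt> : ∀ {s t} → s ≤T t → s ≢ t → wt t ℕ.< wt s
<T⇒wt> p ne with strict p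
  where
  strict : ∀ {s t} → s ≤T t → s ≡ t ⊎ wt t ℕ.< wt s
  strict ε = inj₁ refl
  strict (st ◅ p) with strict p
  ... | inj₁ refl = inj₂ (wt-step st)
  ... | inj₂ lt   = inj₂ (ℕP.<-trans lt (wt-step st))
... | inj₁ e  = ⊥-elim (ne e)
... | inj₂ lt = lt

-- Mirror image of `wt`: it increases along rotations and so measures inductions that go down in the
-- order.
rwt : Tree → ℕ
rwt leaf       = 0
rwt (node l r) = size r + rwt l + rwt r

rwt-step : ∀ {t s} → t ⟶ s → rwt t ℕ.< rwt s
rwt-step (rot A B C) = subst (rwt (node (node A B) C) ℕ.<_)
  (sym (lemma (size B) (size C) (rwt A) (rwt B) (rwt C))) (s≤s (ℕP.m≤m+n _ (size C)))
  where
  lemma : ∀ b c ra rb rc → suc (b + c) + ra + (c + rb + rc)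
    ≡ suc ((c + (b + ra + rb) + rc) + c)
  lemma = ℕSolver.solve-∀
rwt-step (congˡ t st) = ℕP.+-monoˡ-< (rwt t) (ℕP.+-monoʳ-< (size t) (rwt-step st))
rwt-step (congʳ s {t} st) rewrite size-step st = ℕP.+-monoʳ-< (size t + rwt s) (rwt-step st)

<T⇒rwt< : ∀ {s t} → s ≤T t → s ≢ t → rwt s ℕ.< rwt t
<T⇒rwt< p ne with strict p
  where
  strict : ∀ {s t} → s ≤T t → s ≡ t ⊎ rwt s ℕ.< rwt t
  strict ε = inj₁ refl
  strict (st ◅ p) with strict p
  ... | inj₁ refl = inj₂ (rwt-step st)
  ... | inj₂ lt   = inj₂ (ℕP.<-trans (rwt-step st) lt)
... | inj₁ e  = ⊥-elim (ne e)
... | inj₂ lt = lt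

≤T-antisym : ∀ {s t} → s ≤T t → t ≤T s → s ≡ t
≤T-antisym {s} {t} p q with s ≟T t
... | yes e = e
... | no ne = ⊥-elim (ℕP.<-asym (<T⇒wt> p ne) (<T⇒wt> q (ne ∘ sym)))

-- Matching directly on s ≤T? t would get stuck, since leqᵇ and μ also unfold to tests of s ≟T t.
≤T-cases : ∀ s t → (s ≤T t × leqᵇ s t ≡ true) ⊎ (¬ s ≤T t × leqᵇ s t ≡ false)
≤T-cases s t = cases (s ≤T? t)
  where
  cases : (d : Dec (s ≤T t)) → (s ≤T t × does d ≡ true) ⊎ (¬ s ≤T t × does d ≡ false)
  cases (yes p) = inj₁ (p , refl)
  cases (no np) = inj₂ (np , refl)

≡-cases : ∀ s t → (s ≡ t × eqᵇ s t ≡ true) ⊎ (s ≢ t × eqᵇ s t ≡ false)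
≡-cases s t with s ≟T t
... | yes p = inj₁ (p , refl)
... | no np = inj₂ (np , refl)

-- Kronecker delta and coefficients in the monomial basis.

δ : Tree → Tree → ℤ
δ x y = ⟦ eqᵇ x y ⟧

δ-refl : ∀ x → δ x x ≡ + 1
δ-refl x = cong ⟦_⟧ (dec-true (x ≟T x) refl)

δ-≢ : ∀ {x y} → x ≢ y → δ x y ≡ + 0
δ-≢ {x} {y} ne = cong ⟦_⟧ (dec-false (x ≟T y) ne)

δ-subst : ∀ x y (f : Tree → ℤ) → δ x y * f x ≡ δ x y * f y
δ-subst x y f with x ≟T y
... | yes refl = refl
... | no _     = refl

δ-sym : ∀ x y → δ x y ≡ δ y x
δ-sym x y with x ≟T y
... | yes refl = sym (δ-refl x)
... | no ne    = sym (δ-≢ (ne ∘ sym))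

δ-node : ∀ a b c d → δ (node a b) (node c d) ≡ δ a c * δ b d
δ-node a b c d with a ≟T c | b ≟T d
... | yes refl | yes refl = refl
... | yes refl | no _     = refl
... | no _     | _        = refl

-- Each tree of height at most `h` is listed exactly once, and the size bounds the height.
∑-upToHeight-δ : ∀ h y → size y ℕ.≤ h → (f : Tree → ℤ) → ∑ (upToHeight h) (λ x → δ y x * f x) ≡ f y
∑-upToHeight-δ zero leaf y≤h f = trans (ℤP.+-identityʳ _) (ℤP.*-identityˡ (f leaf))
∑-upToHeight-δ (suc h) leaf y≤h f = begin
  _ ≡⟨ cong (_+ℤ_ (+ 1 * f leaf)) (trans (∑-concatMap (upToHeight h) _ _)
         (∑-zero (upToHeight h) (λ l _ → trans (∑-map (upToHeight h) (node l) _)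
           (∑-zero (upToHeight h) (λ _ _ → refl))))) ⟩
  _ ≡⟨ trans (ℤP.+-identityʳ _) (ℤP.*-identityˡ (f leaf)) ⟩
  _ ∎
∑-upToHeight-δ (suc h) (node a b) (s≤s y≤h) f = begin
  _ ≡⟨ ℤP.+-identityˡ _ ⟩
  _ ≡⟨ ∑-concatMap (upToHeight h) _ _ ⟩
  _ ≡⟨ ∑-cong (upToHeight h) (λ l → trans (∑-map (upToHeight h) (node l) _)
         (trans (∑-cong (upToHeight h) (λ r → trans (cong (_* f (node l r)) (δ-node a b l r))
           (ℤP.*-assoc (δ a l) (δ b r) (f (node l r)))))
         (sym (∑-*ˡ (upToHeight h) (δ a l) _)))) ⟩
  _ ≡⟨ ∑-cong (upToHeight h) (λ l → cong (δ a l *_)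
         (∑-upToHeight-δ h b (ℕP.≤-trans (ℕP.m≤n+m _ (size a)) y≤h) (f ∘ node l))) ⟩
  _ ≡⟨ ∑-upToHeight-δ h a (ℕP.≤-trans (ℕP.m≤m+n _ (size b)) y≤h) (λ l → f (node l b)) ⟩
  _ ∎

∑-𝒴-δ : ∀ {n} y → size y ≡ n → (f : Tree → ℤ) → ∑ (𝒴 n) (λ x → δ y x * f x) ≡ f y
∑-𝒴-δ y refl f = begin
  _ ≡⟨ ∑-filter _ (upToHeight (size y)) _ ⟩
  _ ≡⟨ ∑-cong (upToHeight (size y)) (λ x → *-swapˡ ⟦ size x ≡ᵇ size y ⟧ (δ y x) (f x)) ⟩
  _ ≡⟨ ∑-upToHeight-δ (size y) y ℕP.≤-refl (λ x → ⟦ size x ≡ᵇ size y ⟧ * f x) ⟩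
  ⟦ size y ≡ᵇ size y ⟧ * f y
    ≡⟨ cong (λ b → ⟦ b ⟧ * f y) (Equivalence.to T-≡ (ℕP.≡⇒≡ᵇ (size y) (size y) refl)) ⟩
  _ ≡⟨ ℤP.*-identityˡ (f y) ⟩
  _ ∎

∑-𝒴-δ-le : ∀ y t → ∑ (𝒴 (size t)) (λ x → δ y x * le x t) ≡ le y t
∑-𝒴-δ-le y t with size y ℕ.≟ size t
... | yes e = ∑-𝒴-δ y e (λ x → le x t)
... | no ne = trans (∑-zero (𝒴 (size t)) (λ x _ → trans (sym (δ-subst y x (λ z → le z t)))
    (trans (cong (δ y x *_) zero-le) (ℤP.*-zeroʳ (δ y x))))) (sym zero-le)
  where
  zero-le : le y t ≡ + 0
  zero-le = le-no (ne ∘ ≤T-size)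

-- The coefficient of M_t in a combination of the F_x, since F_x is the sum of the M_t with t ≥ x.
coeffM : Tree → Lin → ℤ
coeffM t a = ∑ a (λ (c , x) → c * le x t)

coeffM-coeffF : ∀ t a → coeffM t a ≡ ∑ (𝒴 (size t)) (λ x → coeffF a x * le x t)
coeffM-coeffF t a = sym (begin
  _ ≡⟨ ∑-cong (𝒴 (size t)) (λ x → trans (∑-*ʳ a (le x t) _)
         (∑-cong a (λ (c , y) → trans (cong (_* le x t) (if-⟦⟧ (eqᵇ y x) c)) (rotate (δ y x) c (le x t))))) ⟩
  _ ≡⟨ ∑-swap (𝒴 (size t)) a _ ⟩
  _ ≡⟨ ∑-cong a (λ (c , y) → trans (sym (∑-*ˡ (𝒴 (size t)) c _)) (cong (c *_) (∑-𝒴-δ-le y t))) ⟩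
  _ ∎)
  where
  rotate : ∀ a b c → (a * b) * c ≡ b * (a * c)
  rotate = solve-∀

-- The change of basis is unitriangular: the weight `le x t - δ t x` is supported on the `x`
-- strictly below `t`.
coeffM-coeffF-split : ∀ t a → coeffM t a ≡
  coeffF a t +ℤ ∑ (𝒴 (size t)) (λ x → coeffF a x * (le x t - δ t x))
coeffM-coeffF-split t a = begin
  _ ≡⟨ coeffM-coeffF t a ⟩
  _ ≡⟨ ∑-cong (𝒴 (size t)) (λ x → split (coeffF a x) (le x t) (δ t x)) ⟩
  _ ≡⟨ ∑-+ (𝒴 (size t)) _ _ ⟩
  _ ≡⟨ cong (_+ℤ ∑ (𝒴 (size t)) (λ x → coeffF a x * (le x t - δ t x))) (∑-𝒴-δ t refl (coeffF a)) ⟩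
  _ ∎
  where
  split : ∀ c l d → c * l ≡ d * c +ℤ c * (l - d)
  split = solve-∀

-- The unitriangular system is solved upwards: agreement at all `x` strictly below `t` cancels the
-- sum and leaves the coefficients at `t`.
coeffM-injective : ∀ a b → (∀ t → coeffM t a ≡ coeffM t b) → ∀ t → coeffF a t ≡ coeffF b t
coeffM-injective a b eq t = go (suc (rwt t)) t ℕP.≤-refl
  where
  go : ∀ n t → rwt t ℕ.< n → coeffF a t ≡ coeffF b t
  go (suc n) t (s≤s lt) = ∙-cancelʳ (∑ (𝒴 (size t)) (λ x → coeffF a x * (le x t - δ t x))) _ _ (begin
    _ ≡⟨ coeffM-coeffF-split t a ⟨
    _ ≡⟨ eq t ⟩
    _ ≡⟨ coeffM-coeffF-split t b ⟩
    _ ≡⟨ cong (_+ℤ_ (coeffF b t)) (∑-cong (𝒴 (size t)) below) ⟨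
    _ ∎)
    where
    below : ∀ x → coeffF a x * (le x t - δ t x) ≡ coeffF b x * (le x t - δ t x)
    below x with t ≟T x | x ≤T? t
    ... | yes refl | _ rewrite le-yes {t} {t} ε = trans (ℤP.*-zeroʳ (coeffF a t)) (sym (ℤP.*-zeroʳ (coeffF b t)))
    ... | no ne | yes p = cong (_* (le x t - + 0)) (go n x (ℕP.<-≤-trans (<T⇒rwt< p (ne ∘ sym)) lt))
    ... | no ne | no np rewrite le-no np = trans (ℤP.*-zeroʳ (coeffF a x)) (sym (ℤP.*-zeroʳ (coeffF b x)))

-- Möbius inversion

mobF-refl : ∀ k s → mobF (suc k) s s ≡ + 1
mobF-refl k s rewrite dec-true (s ≟T s) refl = refl

mobF-≰ : ∀ k {s t} → ¬ s ≤T t → mobF k s t ≡ + 0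
mobF-≰ zero    np = refl
mobF-≰ (suc k) {s} {t} np
  rewrite dec-false (s ≟T t) (λ { refl → np ε }) | dec-false (s ≤T? t) np = refl

interval : Tree → Tree → Tree → Bool
interval s t u = leqᵇ s u ∧ (leqᵇ u t ∧ not (eqᵇ u t))

mobF-< : ∀ k {s t} → s ≤T t → s ≢ t →
  mobF (suc k) s t ≡ - ∑ (filterᵇ (interval s t) (𝒴 (size s))) (mobF k s)
mobF-< k {s} {t} p ne rewrite dec-false (s ≟T t) ne | dec-true (s ≤T? t) p = refl

∑-interval-cong : ∀ s t {f g : Tree → ℤ} → (∀ u → u ≤T t → u ≢ t → f u ≡ g u) →
  ∑ (filterᵇ (interval s t) (𝒴 (size s))) f ≡ ∑ (filterᵇ (interval s t) (𝒴 (size s))) g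
∑-interval-cong s t {f} {g} e = begin
  _ ≡⟨ ∑-filter _ (𝒴 (size s)) f ⟩
  _ ≡⟨ ∑-cong (𝒴 (size s)) each ⟩
  _ ≡⟨ ∑-filter _ (𝒴 (size s)) g ⟨
  _ ∎
  where
  each : ∀ u → ⟦ interval s t u ⟧ * f u ≡ ⟦ interval s t u ⟧ * g u
  empty : ∀ u → interval s t u ≡ false → ⟦ interval s t u ⟧ * f u ≡ ⟦ interval s t u ⟧ * g u
  empty u eq rewrite eq = refl
  each u with ≤T-cases u t | ≡-cases u t
  ... | inj₁ (p , _)  | inj₂ (ne , _) = cong (⟦ interval s t u ⟧ *_) (e u p ne)
  ... | inj₂ (_ , eq) | _ = empty u (trans (cong (λ b → leqᵇ s u ∧ (b ∧ not (eqᵇ u t))) eq) (∧-zeroʳ (leqᵇ s u)))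
  ... | inj₁ (_ , eq) | inj₁ (_ , eq') =
    empty u (trans (cong₂ (λ b c → leqᵇ s u ∧ (b ∧ not c)) eq eq') (∧-zeroʳ (leqᵇ s u)))

≤T-wt : ∀ {s t} → s ≤T t → ¬ wt s ℕ.< wt t
≤T-wt {s} {t} p h with s ≟T t
... | yes refl = ℕP.<-irrefl refl h
... | no ne    = ℕP.<-asym h (<T⇒wt> p ne)

-- Recursive calls go to u < t, where `wt` is larger, so any fuel above the difference of `wt s` and
-- `wt t` gives the same value; the additive form avoids truncated subtraction.
mobF-fuel : ∀ k k' s t → wt s ℕ.< k + wt t → wt s ℕ.< k' + wt t → mobF k s t ≡ mobF k' s t
mobF-fuel k k' s t h h' with ≤T-cases s t
... | inj₂ (np , _) = trans (mobF-≰ k np) (sym (mobF-≰ k' np))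
mobF-fuel zero k' s t h h' | inj₁ (p , _) = ⊥-elim (≤T-wt p h)
mobF-fuel (suc k) zero s t h h' | inj₁ (p , _) = ⊥-elim (≤T-wt p h')
mobF-fuel (suc k) (suc k') s t h h' | inj₁ (p , _) with ≡-cases s t
... | inj₁ (refl , _) = trans (mobF-refl k s) (sym (mobF-refl k' s))
... | inj₂ (ne , _) = begin
  mobF (suc k) s t  ≡⟨ mobF-< k p ne ⟩
  _ ≡⟨ cong -_ (∑-interval-cong s t (λ u q ne' →
         mobF-fuel k k' s u (fuel k u h (<T⇒wt> q ne')) (fuel k' u h' (<T⇒wt> q ne')))) ⟩
  _ ≡⟨ mobF-< k' p ne ⟨
  mobF (suc k') s t ∎
  where
  fuel : ∀ k u → wt s ℕ.< suc k + wt t → wt t ℕ.< wt u → wt s ℕ.< k + wt u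
  fuel k u h lt = ℕP.<-≤-trans h (subst (ℕ._≤ k + wt u) (ℕP.+-suc k (wt t)) (ℕP.+-monoʳ-≤ k lt))

-- For u < p, the terms with s < p form the sum in the recursion for μ(u,p), and the term s = p
-- cancels it. For u = p, antisymmetry leaves s = u alone; if u is not below p, transitivity leaves
-- nothing.
coeffM-M : ∀ u p → coeffM p (M u) ≡ δ u p
coeffM-M u p = trans (trans (∑-map (filterᵇ (leqᵇ u) (𝒴 (size u))) _ _) (∑-filter _ (𝒴 (size u)) _)) cases
  where
  term : Tree → ℤ
  term s = ⟦ leqᵇ u s ⟧ * (μ u s * le s p)
  weigh : ∀ {a a' l l' d d'} m → a ≡ a' → l ≡ l' → d ≡ d' → a' * (m * l') ≡ d' * m → a * (m * l) ≡ d * m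
  weigh m refl refl refl e = e
  cases : ∑ (𝒴 (size u)) term ≡ δ u p
  cases with ≡-cases u p | ≤T-cases u p
  ... | inj₁ (refl , _) | _ = begin
    _ ≡⟨ ∑-cong (𝒴 (size u)) only ⟩
    _ ≡⟨ ∑-𝒴-δ u refl (μ u) ⟩
    _ ≡⟨ mobF-refl (wt u) u ⟩
    + 1 ≡⟨ δ-refl u ⟨
    δ u u ∎
    where
    only : ∀ s → term s ≡ δ u s * μ u s
    only s with ≤T-cases u s | ≡-cases u s
    ... | inj₁ (q , e) | inj₁ (refl , e') =
          weigh (μ u u) (cong ⟦_⟧ e) (le-yes {u} {u} ε) (cong ⟦_⟧ e') (cong (+ 1 *_) (ℤP.*-identityʳ (μ u u)))
    ... | inj₁ (q , e) | inj₂ (ne , e') =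
          weigh (μ u s) (cong ⟦_⟧ e) (le-no {s} {u} (λ r → ne (≤T-antisym q r))) (cong ⟦_⟧ e')
            (cong (+ 1 *_) (ℤP.*-zeroʳ (μ u s)))
    ... | inj₂ (q , _) | inj₁ (refl , _) = ⊥-elim (q ε)
    ... | inj₂ (_ , e) | inj₂ (_ , e') = weigh (μ u s) (cong ⟦_⟧ e) (refl {x = le s u}) (cong ⟦_⟧ e') refl
  ... | inj₂ (ne , _) | inj₂ (np , _) = trans (∑-zero (𝒴 (size u)) (λ s _ → none s)) (sym (δ-≢ ne))
    where
    none : ∀ s → term s ≡ + 0
    none s with ≤T-cases u s
    ... | inj₂ (_ , e) = weigh {d = + 0} (μ u s) (cong ⟦_⟧ e) (refl {x = le s p}) refl refl
    ... | inj₁ (q , e) = weigh {d = + 0} (μ u s) (cong ⟦_⟧ e) (le-no {s} {p} (λ r → np (q ◅◅ r))) refl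
          (cong (+ 1 *_) (ℤP.*-zeroʳ (μ u s)))
  ... | inj₂ (ne , _) | inj₁ (u≤p , _) = begin
    _ ≡⟨ ∑-cong (𝒴 (size u)) split ⟩
    _ ≡⟨ ∑-+ (𝒴 (size u)) _ _ ⟩
    _ ≡⟨ cong₂ _+ℤ_ (trans (sym (∑-filter _ (𝒴 (size u)) (μ u))) (∑-interval-cong u p shrink))
           (∑-𝒴-δ p (sym (≤T-size u≤p)) (μ u)) ⟩
    X +ℤ μ u p ≡⟨ cong (_+ℤ_ X) (mobF-< (wt u) u≤p ne) ⟩
    X - X ≡⟨ ℤP.+-inverseʳ X ⟩
    + 0 ≡⟨ δ-≢ ne ⟨
    δ u p ∎
    where
    X = ∑ (filterᵇ (interval u p) (𝒴 (size u))) (mobF (wt u) u)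
    -- `μ` has one more unit of fuel than the calls inside `μ u p`. As `s` is strictly below `p`,
    -- `wt s` is positive, and the smaller fuel suffices.
    shrink : ∀ s → s ≤T p → s ≢ p → μ u s ≡ mobF (wt u) u s
    shrink s q ne' = mobF-fuel (suc (wt u)) (wt u) u s (s≤s (ℕP.m≤m+n _ _))
      (ℕP.≤-trans (ℕP.≤-reflexive (ℕP.+-comm 1 (wt u)))
        (ℕP.+-monoʳ-≤ (wt u) (ℕP.≤-trans (s≤s z≤n) (<T⇒wt> q ne'))))
    split : ∀ s → term s ≡ ⟦ interval u p s ⟧ * μ u s +ℤ δ p s * μ u s
    split s rewrite le-≤T? s p | δ-sym p s =
      booleans (leqᵇ u s) (leqᵇ s p) (eqᵇ s p) (μ u s) consistent
      where
      consistent : eqᵇ s p ≡ true → leqᵇ u s ≡ true × leqᵇ s p ≡ true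
      consistent e with ≡-cases s p
      ... | inj₁ (refl , _) = dec-true (u ≤T? s) u≤p , dec-true (s ≤T? s) ε
      ... | inj₂ (_ , e') with () ← trans (sym e) e'
      booleans : ∀ a b c m → (c ≡ true → a ≡ true × b ≡ true) →
        ⟦ a ⟧ * (m * ⟦ b ⟧) ≡ ⟦ a ∧ (b ∧ not c) ⟧ * m +ℤ ⟦ c ⟧ * m
      booleans a     b     true  m h with h refl
      ... | refl , refl = lemma m
        where
        lemma : ∀ m → + 1 * (m * + 1) ≡ + 0 * m +ℤ + 1 * m
        lemma = solve-∀
      booleans true  true  false m h = lemma m
        where
        lemma : ∀ m → + 1 * (m * + 1) ≡ + 1 * m +ℤ + 0 * m
        lemma = solve-∀
      booleans true  false false m h = cong (+ 1 *_) (ℤP.*-zeroʳ m)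
      booleans false b     false m h = refl

-- Admissible subsets

∑-subsets-node : ∀ {l r} (f : Sub (node l r) → ℤ) → ∑ (subsets (node l r)) f ≡
  ∑ (subsets l) (λ S → ∑ (subsets r) (λ T → f (snode true S T)))
  +ℤ ∑ (subsets l) (λ S → ∑ (subsets r) (λ T → f (snode false S T)))
∑-subsets-node {l} {r} f = trans (∑-concatMap (true ∷ false ∷ [])
    (λ b → concatMap (λ S → map (snode b S) (subsets r)) (subsets l)) f)
  (cong₂ _+ℤ_ (part true) (trans (ℤP.+-identityʳ _) (part false)))
  where
  part : ∀ b → ∑ (concatMap (λ S → map (snode b S) (subsets r)) (subsets l)) f ≡
    ∑ (subsets l) (λ S → ∑ (subsets r) (λ T → f (snode b S T)))
  part b = trans (∑-concatMap (subsets l) _ f) (∑-cong (subsets l) (λ S → ∑-map (subsets r) _ f))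

-- Only the full subset is counted. In `∑-admissible` this factor settles the left subtree of a
-- pruned root, where `prune` makes no use of the subset.
∑-allIn : ∀ t → ∑ (subsets t) (λ S → ⟦ allIn S ∧ admissible S ⟧) ≡ + 1
∑-allIn leaf       = refl
∑-allIn (node l r) = begin
  _ ≡⟨ ∑-subsets-node {l} {r} _ ⟩
  _ ≡⟨ cong₂ _+ℤ_ (trans
         (∑-cong (subsets l) (λ S → ∑-cong (subsets r) (λ T →
           trans (cong ⟦_⟧ (regroup (allIn S) (allIn T) (admissible S) (admissible T)))
             (⟦∧⟧ (allIn S ∧ admissible S) (allIn T ∧ admissible T)))))
         (sym (∑-*-∑ (subsets l) (subsets r) _ _)))
         (∑-zero (subsets l) (λ _ _ → ∑-zero (subsets r) (λ _ _ → refl))) ⟩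
  _ ≡⟨ cong (_+ℤ + 0) (cong₂ _*_ (∑-allIn l) (∑-allIn r)) ⟩
  + 1 ∎
  where
  regroup : ∀ a b c d → (a ∧ b) ∧ (a ∧ (c ∧ d)) ≡ (a ∧ c) ∧ (b ∧ d)
  regroup false b     c     d = refl
  regroup true  true  c     d = refl
  regroup true  false true  d = refl
  regroup true  false false d = refl

∑-admissible : ∀ t (f : Tree × Tree → ℤ) →
  ∑ (subsets t) (λ S → ⟦ admissible S ⟧ * f (prune S)) ≡ ∑ (prunings t) f
∑-admissible leaf       f = cong (_+ℤ + 0) (ℤP.*-identityˡ (f (leaf , leaf)))
∑-admissible (node l r) f = begin
  _ ≡⟨ ∑-subsets-node {l} {r} _ ⟩
  _ ≡⟨ cong₂ _+ℤ_ (trans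
         (∑-cong (subsets l) (λ S → ∑-cong (subsets r) (λ T →
           trans (cong (_* g T) (trans (cong ⟦_⟧ (assoc (allIn S) (admissible S) (admissible T)))
             (⟦∧⟧ (allIn S ∧ admissible S) (admissible T))))
             (ℤP.*-assoc ⟦ allIn S ∧ admissible S ⟧ ⟦ admissible T ⟧ (g T)))))
         (trans (sym (∑-*-∑ (subsets l) (subsets r) _ _))
           (cong₂ _*_ (∑-allIn l) (∑-admissible r (f ∘ map₁ (node l))))))
       (∑-cong (subsets l) (λ S → trans (∑-cong (subsets r) (λ T →
           trans (cong (_* h (prune S) (prune T)) (⟦∧⟧ (admissible S) (admissible T)))
             (ℤP.*-assoc ⟦ admissible S ⟧ ⟦ admissible T ⟧ (h (prune S) (prune T)))))
         (trans (sym (∑-*ˡ (subsets r) ⟦ admissible S ⟧ _))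
           (cong (⟦ admissible S ⟧ *_) (∑-admissible r (h (prune S))))))) ⟩
  _ ≡⟨ cong₂ _+ℤ_ (ℤP.*-identityˡ (∑ (prunings r) (f ∘ map₁ (node l)))) (∑-admissible l (λ s → ∑ (prunings r) (h s))) ⟩
  _ ≡⟨ ∑-prunings-node l r f ⟨
  _ ∎
  where
  g : Sub r → ℤ
  g T = f (map₁ (node l) (prune T))
  h : Tree × Tree → Tree × Tree → ℤ
  h (s' , s'') (p , q) = f (s' ∖ p , node s'' q)
  assoc : ∀ a b c → a ∧ (b ∧ c) ≡ (a ∧ b) ∧ c
  assoc true  b c = refl
  assoc false b c = refl

+count : ∀ t u v → + count t u v ≡ ∑ (prunings t) (λ (p , q) → δ p u * δ q v)
+count t u v = begin
  _ ≡⟨ length-filter _ (subsets t) ⟩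
  _ ≡⟨ ∑-cong (subsets t) (λ S → trans (⟦∧⟧ (admissible S) _)
         (cong (⟦ admissible S ⟧ *_) (⟦∧⟧ (eqᵇ (proj₁ (prune S)) u) _))) ⟩
  _ ≡⟨ ∑-admissible t _ ⟩
  _ ∎

size-∖ : ∀ s t → size (s ∖ t) ≡ size s + size t
size-∖ leaf       t = refl
size-∖ (node a b) t = cong suc (trans (cong (_+_ (size a)) (size-∖ b t)) (sym (ℕP.+-assoc (size a) _ _)))

size-prune : ∀ {t} (S : Sub t) → size (proj₁ (prune S)) + size (proj₂ (prune S)) ≡ size t
size-prune sleaf = refl
size-prune {node s t} (snode true S T) =
  cong suc (trans (ℕP.+-assoc (size s) _ _) (cong (_+_ (size s)) (size-prune T)))
size-prune {node s t} (snode false S T)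
  rewrite size-∖ (proj₁ (prune S)) (proj₁ (prune T)) | sym (size-prune S) | sym (size-prune T) =
  lemma (size (proj₁ (prune S))) (size (proj₁ (prune T))) _ _
  where
  lemma : ∀ a b c d → (a + b) + suc (c + d) ≡ suc ((a + c) + (b + d))
  lemma = ℕSolver.solve-∀

count-size : ∀ t u v → size t ≢ size u + size v → count t u v ≡ 0
count-size t u v ne = ℤP.+-injective (trans (length-filter _ (subsets t)) (∑-zero (subsets t) (λ S _ → none S)))
  where
  none : (S : Sub t) → ⟦ admissible S ∧ (eqᵇ (proj₁ (prune S)) u ∧ eqᵇ (proj₂ (prune S)) v) ⟧ ≡ + 0
  none S with admissible S | proj₁ (prune S) ≟T u | proj₂ (prune S) ≟T v
  ... | false | _        | _        = refl
  ... | true  | no _     | _        = refl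
  ... | true  | yes _    | no _     = refl
  ... | true  | yes e    | yes e'   = ⊥-elim (ne (sym (subst₂ (λ a b → size a + size b ≡ size t) e e' (size-prune S))))

-- The two sides compared in the monomial basis.

coeffM-scale : ∀ t c a → coeffM t (scale c a) ≡ c * coeffM t a
coeffM-scale t c a = trans (∑-map a _ _) (trans (∑-cong a (λ (d , x) → ℤP.*-assoc c d (le x t)))
  (sym (∑-*ˡ a c _)))

coeffM-rhs : ∀ u v t → coeffM t (rhs u v) ≡ + count t u v
coeffM-rhs u v t = begin
  _ ≡⟨ ∑-concatMap (𝒴 n) _ _ ⟩
  _ ≡⟨ ∑-cong (𝒴 n) (λ r → trans (coeffM-scale t (+ count r u v) (M r))
         (trans (cong (+ count r u v *_) (trans (coeffM-M r t) (δ-sym r t))) (ℤP.*-comm (+ count r u v) (δ t r)))) ⟩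
  ∑ (𝒴 n) (λ r → δ t r * + count r u v) ≡⟨ pick ⟩
  _ ∎
  where
  n = size u + size v
  pick : ∑ (𝒴 n) (λ r → δ t r * + count r u v) ≡ + count t u v
  pick with size t ℕ.≟ n
  ... | yes e = ∑-𝒴-δ t e (λ r → + count r u v)
  ... | no ne = trans (∑-zero (𝒴 n) (λ r _ → trans (sym (δ-subst t r (λ z → + count z u v)))
          (trans (cong (λ z → δ t r * + z) (count-size t u v ne)) (ℤP.*-zeroʳ (δ t r)))))
          (cong +_ (sym (count-size t u v ne)))

-- The weight `le a p * le b q` factors, so Möbius inversion applies separately over `M u` and `M v`
-- and turns the two inequalities into equalities.
coeffM-⋆ : ∀ u v t → coeffM t (M u ⋆ M v) ≡ + count t u v
coeffM-⋆ u v t = begin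
  coeffM t (M u ⋆ M v)
    ≡⟨ trans (∑-concatMap (M u) _ _) (∑-cong (M u) (λ (c , a) →
         trans (∑-concatMap (M v) _ _) (∑-cong (M v) (λ (d , b) →
           trans (coeffM-scale t (c * d) (prodF a b)) (cong (c * d *_)
             (trans (∑-prodF a b (λ x → le x t)) (∑-shuffles-le a b t))))))) ⟩
  ∑ (M u) (λ (c , a) → ∑ (M v) (λ (d , b) → c * d * ∑ (prunings t) (λ (p , q) → le a p * le b q)))
    ≡⟨ ∑-cong (M u) (λ (c , a) → trans (∑-cong (M v) (λ (d , b) → trans (∑-*ˡ (prunings t) (c * d) _)
         (∑-cong (prunings t) (λ (p , q) → *-interchange c d (le a p) (le b q)))))
         (∑-swap (M v) (prunings t) _)) ⟩
  _ ≡⟨ ∑-swap (M u) (prunings t) _ ⟩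
  _ ≡⟨ ∑-cong (prunings t) (λ (p , q) → sym (∑-*-∑ (M u) (M v) _ _)) ⟩
  ∑ (prunings t) (λ (p , q) → coeffM p (M u) * coeffM q (M v))
    ≡⟨ ∑-cong (prunings t) (λ (p , q) → cong₂ _*_ (trans (coeffM-M u p) (δ-sym u p))
         (trans (coeffM-M v q) (δ-sym v q))) ⟩
  _ ≡⟨ +count t u v ⟨
  _ ∎

-- By duality, the coefficient of M*_u ⊗ M*_v in Δ(M*_t) is that of M_t in M_u · M_v, so the
-- coproduct formula says that this product is `rhs u v`. The second component covers the trees `t`
-- outside the finite sum in `rhs`.
theorem8p4 : (u v : Tree) →
    ((x : Tree) → coeffF (M u ⋆ M v) x ≡ coeffF (rhs u v) x)
    × ((t : Tree) → size t ≢ size u + size v → count t u v ≡ 0)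
theorem8p4 u v =
  coeffM-injective (M u ⋆ M v) (rhs u v) (λ t → trans (coeffM-⋆ u v t) (sym (coeffM-rhs u v t))) ,
  (λ t → count-size t u v)
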